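{- Fix an integer $q \geq 3$. For each $f$, let $\Lambda_{f,q}$ be a uniformly random numerical semigroup of depth $q$ with Frobenius number $f$, and $m(\Lambda_{f,q})$ its multiplicity. Then for every $\varepsilon > 0$, \[\lim_{f \to \infty} \mathbb{P}\big(|f - (q-1)\, m(\Lambda_{f,q})| < \varepsilon f\big) = 1.\]
   Context: A numerical semigroup is a subset $\Lambda \subseteq \mathbb{N}_0$ containing $0$, closed under addition, with finite complement. Its multiplicity is $m(\Lambda) = \min(\Lambda\setminus\{0\})$, its conductor $c(\Lambda)$ is the least $c$ with $c + \mathbb{N}_0 \subseteq \Lambda$, its Frobenius number is $c(\Lambda)-1$, and its depth is $\lceil c(\Lambda)/m(\Lambda) \rceil$. -}

module Defs where

open import Data.Bool.Base using (Bool; true; false)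
import Data.Bool.Properties as Bool
open import Data.Empty using (⊥-elim)
open import Data.Integer.Base as ℤ using (ℤ; +_; 1ℤ)
import Data.Integer.Properties as ℤ
open import Data.List.Base using (List; []; _∷_; _++_; map; filter; length; upTo)
open import Data.List.Extrema.Nat using (max; xs≤max)
open import Data.List.Membership.Propositional using () renaming (_∈_ to _∈ₗ_)
import Data.List.Membership.Propositional.Properties as Membershipₚ
import Data.List.Membership.Setoid as SetoidMembership
import Data.List.Membership.Setoid.Properties as SetoidMembershipₚ
open import Data.List.Relation.Unary.All as All using (All; []; _∷_)
open import Data.List.Relation.Unary.All.Properties using (all-filter)
open import Data.List.Relation.Unary.AllPairs using ([]; _∷_)
open import Data.List.Relation.Unary.Any using (here; there)
import Data.List.Relation.Unary.Unique.Propositional as Propositional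
import Data.List.Relation.Unary.Unique.Propositional.Properties as Propositionalₚ
import Data.List.Relation.Unary.Unique.Setoid as SetoidUnique
import Data.List.Relation.Unary.Unique.Setoid.Properties as SetoidUniqueₚ
open import Data.Nat.Base using (ℕ; zero; suc; pred; _+_; _∸_; _≤_; _<_; z≤n; s≤s; NonZero; ≢-nonZero)
open import Data.Nat.DivMod using (_/_)
open import Data.Nat.Properties using (_≟_; _<?_; ≤-antisym; ≤-trans; ≮⇒≥; <⇒≱; m≤m+n; m≤n+m; m+[n∸m]≡n; allUpTo?)
open import Data.Product.Base using (∃; _×_; _,_; proj₁; proj₂)
open import Data.Rational.Base as ℚ using (ℚ)
import Data.Rational.Properties as ℚ
open import Data.Sum.Base using (_⊎_; inj₁; inj₂)
open import Data.Unit.Base using (⊤; tt)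
open import Data.Vec.Base using (Vec; []; _∷_)
open import Level using (Level; 0ℓ; _⊔_) renaming (suc to lsuc)
open import Relation.Binary.Bundles using (Setoid)
open import Relation.Binary.Definitions using (_Respects_)
open import Relation.Binary.PropositionalEquality using (_≡_; _≢_; refl; sym; trans; cong; cong₂; subst)
open import Relation.Nullary using (¬_; yes; no)
open import Relation.Nullary.Decidable using (does; ¬?; map′; _×-dec_; _⊎-dec_; _→-dec_)
open import Relation.Unary using (Pred; Decidable; _∈_; _∉_; _≐_)

private
  variable
    a ℓ p : Level
    k : ℕ

IsLeast : Pred ℕ p → Pred ℕ p
IsLeast P n = P n × (∀ k → P k → n ≤ k)

least : {P : Pred ℕ p} → Decidable P → ∀ n → P n → ∃ (IsLeast P)
least P? zero P0 = 0 , P0 , λ _ _ → z≤n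
least {P = P} P? (suc n) Pn with P? 0
... | yes P0 = 0 , P0 , λ _ _ → z≤n
... | no ¬P0 with least {P = λ k → P (suc k)} (λ k → P? (suc k)) n Pn
...   | m , Pm , m≤ = suc m , Pm , λ where
  zero P0 → ⊥-elim (¬P0 P0)
  (suc k) Pk → s≤s (m≤ k Pk)

IsLeast-unique : {P Q : Pred ℕ p} → P ≐ Q → ∀ {m n} → IsLeast P m → IsLeast Q n → m ≡ n
IsLeast-unique (P⊆Q , Q⊆P) (Pm , m≤) (Qn , n≤) = ≤-antisym (m≤ _ (Q⊆P Qn)) (n≤ _ (P⊆Q Pm))

⌈_/_⌉ : ℕ → (n : ℕ) .{{_ : NonZero n}} → ℕ
⌈ m / n ⌉ = (m + pred n) / n

-- Decidability of membership is classically automatic for a cofinite subset.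
record NumericalSemigroup : Set₁ where
  field
    elements          : Pred ℕ 0ℓ
    elements?         : Decidable elements
    0∈elements        : 0 ∈ elements
    +-closed          : ∀ {x y} → x ∈ elements → y ∈ elements → x + y ∈ elements
    finite-complement : ∃ λ (gaps : List ℕ) → ∀ {n} → n ∉ elements → n ∈ₗ gaps

open NumericalSemigroup public

-- Two numerical semigroups are identified when they have the same elements.
semigroupSetoid : Setoid (lsuc 0ℓ) 0ℓ
semigroupSetoid = record
  { Carrier = NumericalSemigroup
  ; _≈_ = λ Λ Λ′ → elements Λ ≐ elements Λ′
  ; isEquivalence = record
    { refl = (λ x → x) , (λ x → x)
    ; sym = λ (f , g) → g , f
    ; trans = λ (f , g) (h , i) → (λ x → h (f x)) , (λ x → g (i x))
    }
  }

open Setoid semigroupSetoid using () renaming (_≈_ to _≈ₛ_)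

ContainsFrom : NumericalSemigroup → Pred ℕ 0ℓ
ContainsFrom Λ c = ∀ k → c + k ∈ elements Λ

containsFrom? : ∀ Λ → Decidable (ContainsFrom Λ)
containsFrom? Λ c = map′ to from (All.all? (λ g → elements? Λ g ⊎-dec g <? c) gaps)
  where
  gaps = proj₁ (finite-complement Λ)
  to : All (λ g → g ∈ elements Λ ⊎ g < c) gaps → ContainsFrom Λ c
  to all k with elements? Λ (c + k)
  ... | yes ∈Λ = ∈Λ
  ... | no ∉Λ with All.lookup all (proj₂ (finite-complement Λ) ∉Λ)
  ...   | inj₁ ∈Λ = ∈Λ
  ...   | inj₂ c+k<c = ⊥-elim (<⇒≱ c+k<c (m≤m+n c k))
  from : ContainsFrom Λ c → All (λ g → g ∈ elements Λ ⊎ g < c) gaps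
  from h = All.tabulate λ {g} _ → case g
    where
    case : ∀ g → g ∈ elements Λ ⊎ g < c
    case g with g <? c
    ... | yes g<c = inj₂ g<c
    ... | no g≮c = inj₁ (subst (_∈ elements Λ) (m+[n∸m]≡n (≮⇒≥ g≮c)) (h (g ∸ c)))

containsFrom-∃ : ∀ Λ → ∃ (ContainsFrom Λ)
containsFrom-∃ Λ = suc (max 0 gaps) , contains
  where
  gaps = proj₁ (finite-complement Λ)
  contains : ContainsFrom Λ (suc (max 0 gaps))
  contains k with elements? Λ (suc (max 0 gaps) + k)
  ... | yes ∈Λ = ∈Λ
  ... | no ∉Λ = ⊥-elim (<⇒≱ (s≤s (m≤m+n _ k)) (All.lookup (xs≤max 0 gaps) (proj₂ (finite-complement Λ) ∉Λ)))

conductor-∃ : ∀ Λ → ∃ (IsLeast (ContainsFrom Λ))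
conductor-∃ Λ = least (containsFrom? Λ) (proj₁ (containsFrom-∃ Λ)) (proj₂ (containsFrom-∃ Λ))

conductor : NumericalSemigroup → ℕ
conductor Λ = proj₁ (conductor-∃ Λ)

conductor-isLeast : ∀ Λ → IsLeast (ContainsFrom Λ) (conductor Λ)
conductor-isLeast Λ = proj₂ (conductor-∃ Λ)

NonZeroElement : NumericalSemigroup → Pred ℕ 0ℓ
NonZeroElement Λ n = n ∈ elements Λ × n ≢ 0

multiplicity-∃ : ∀ Λ → ∃ (IsLeast (NonZeroElement Λ))
multiplicity-∃ Λ = least (λ n → elements? Λ n ×-dec ¬? (n ≟ 0)) (conductor Λ + 1) (proj₁ (conductor-isLeast Λ) 1 , c+1≢0 (conductor Λ))
  where
  c+1≢0 : ∀ c → c + 1 ≢ 0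
  c+1≢0 zero ()
  c+1≢0 (suc c) ()

multiplicity : NumericalSemigroup → ℕ
multiplicity Λ = proj₁ (multiplicity-∃ Λ)

multiplicity-isLeast : ∀ Λ → IsLeast (NonZeroElement Λ) (multiplicity Λ)
multiplicity-isLeast Λ = proj₂ (multiplicity-∃ Λ)

multiplicity-nonZero : ∀ Λ → NonZero (multiplicity Λ)
multiplicity-nonZero Λ = ≢-nonZero (proj₂ (proj₁ (multiplicity-isLeast Λ)))

-- Integer-valued, since the Frobenius number of ℕ itself is -1.
frobenius : NumericalSemigroup → ℤ
frobenius Λ = + conductor Λ ℤ.- 1ℤ

depth : NumericalSemigroup → ℕ
depth Λ = ⌈ conductor Λ / multiplicity Λ ⌉
  where instance _ = multiplicity-nonZero Λ

HasFrobeniusAndDepth : ℕ → ℕ → Pred NumericalSemigroup 0ℓ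
HasFrobeniusAndDepth f q Λ = frobenius Λ ≡ + f × depth Λ ≡ q

hasFrobeniusAndDepth? : ∀ f q → Decidable (HasFrobeniusAndDepth f q)
hasFrobeniusAndDepth? f q Λ = (frobenius Λ ℤ.≟ + f) ×-dec (depth Λ ≟ q)

conductor-cong : ∀ {Λ Λ′} → Λ ≈ₛ Λ′ → conductor Λ ≡ conductor Λ′
conductor-cong {Λ} {Λ′} (to , from) =
  IsLeast-unique ((λ h k → to (h k)) , (λ h k → from (h k))) (conductor-isLeast Λ) (conductor-isLeast Λ′)

multiplicity-cong : ∀ {Λ Λ′} → Λ ≈ₛ Λ′ → multiplicity Λ ≡ multiplicity Λ′
multiplicity-cong {Λ} {Λ′} (to , from) =
  IsLeast-unique ((λ (h , n≢0) → to h , n≢0) , (λ (h , n≢0) → from h , n≢0)) (multiplicity-isLeast Λ) (multiplicity-isLeast Λ′)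

depth-cong : ∀ {Λ Λ′} → Λ ≈ₛ Λ′ → depth Λ ≡ depth Λ′
depth-cong {Λ} {Λ′} e = ⌈/⌉-cong (conductor-cong {Λ} {Λ′} e) (multiplicity-cong {Λ} {Λ′} e)
  where
  ⌈/⌉-cong : ∀ {c c′ m m′} .{{nz : NonZero m}} .{{nz′ : NonZero m′}} → c ≡ c′ → m ≡ m′ → ⌈ c / m ⌉ ≡ ⌈ c′ / m′ ⌉
  ⌈/⌉-cong refl refl = refl
  instance
    _ = multiplicity-nonZero Λ
    _ = multiplicity-nonZero Λ′

hasFrobeniusAndDepth-resp : ∀ f q → HasFrobeniusAndDepth f q Respects _≈ₛ_
hasFrobeniusAndDepth-resp f q {Λ} {Λ′} e (F , D) =
  trans (cong (λ c → + c ℤ.- 1ℤ) (sym (conductor-cong {Λ} {Λ′} e))) F , trans (sym (depth-cong {Λ} {Λ′} e)) D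

record Enumeration (S : Setoid a ℓ) (P : Pred (Setoid.Carrier S) p) : Set (a ⊔ ℓ ⊔ p) where
  open SetoidMembership S using () renaming (_∈_ to _∈ₛ_)
  field
    list     : List (Setoid.Carrier S)
    sound    : All P list
    complete : ∀ {x} → P x → x ∈ₛ list
    unique   : SetoidUnique.Unique S list

  size : ℕ
  size = length list

  -- Probability of A for a uniformly random x satisfying P.
  ℙ : ∀ {r} {A : Pred (Setoid.Carrier S) r} → Decidable A → .{{_ : NonZero size}} → ℚ
  ℙ A? = + length (filter A? list) ℚ./ size

open Enumeration public using (list; sound; complete; unique; size; ℙ)

-- The bits of v decide membership of the numbers below k; all others belong.
⟦_⟧ : Vec Bool k → Pred ℕ 0ℓ
⟦ [] ⟧    _       = ⊤
⟦ b ∷ v ⟧ zero    = b ≡ true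
⟦ b ∷ v ⟧ (suc n) = ⟦ v ⟧ n

⟦_⟧? : (v : Vec Bool k) → Decidable ⟦ v ⟧
⟦ [] ⟧?    _       = yes tt
⟦ b ∷ v ⟧? zero    = b Bool.≟ true
⟦ b ∷ v ⟧? (suc n) = ⟦ v ⟧? n

⟦⟧-beyond : (v : Vec Bool k) → ∀ {n} → k ≤ n → n ∈ ⟦ v ⟧
⟦⟧-beyond []      _         = tt
⟦⟧-beyond (b ∷ v) (s≤s k≤n) = ⟦⟧-beyond v k≤n

⟦⟧-injective : (v w : Vec Bool k) → ⟦ v ⟧ ≐ ⟦ w ⟧ → v ≡ w
⟦⟧-injective []      []      _           = refl
⟦⟧-injective (b ∷ v) (c ∷ w) (to , from) =
  cong₂ _∷_ (bits b c (to {0}) (from {0})) (⟦⟧-injective v w ((λ {n} → to {suc n}) , (λ {n} → from {suc n})))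
  where
  bits : ∀ b c → (b ≡ true → c ≡ true) → (c ≡ true → b ≡ true) → b ≡ c
  bits true  c     f g = sym (f refl)
  bits false true  f g = g refl
  bits false false f g = refl

characteristic : {P : Pred ℕ 0ℓ} → Decidable P → ∀ k → Vec Bool k
characteristic P? zero    = []
characteristic P? (suc k) = does (P? 0) ∷ characteristic (λ n → P? (suc n)) k

characteristic-≐ : {P : Pred ℕ 0ℓ} (P? : Decidable P) → ∀ k → (∀ n → P (k + n)) → P ≐ ⟦ characteristic P? k ⟧
characteristic-≐ P? zero    h = (λ _ → tt) , (λ {n} _ → h n)
characteristic-≐ {P} P? (suc k) h = (λ {n} → to n) , (λ {n} → from n)
  where
  rec = characteristic-≐ {λ n → P (suc n)} (λ n → P? (suc n)) k h
  to : ∀ n → P n → ⟦ characteristic P? (suc k) ⟧ n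
  to zero    P0 with P? 0
  ... | yes _  = refl
  ... | no ¬P0 = ⊥-elim (¬P0 P0)
  to (suc n) Pn = proj₁ rec Pn
  from : ∀ n → ⟦ characteristic P? (suc k) ⟧ n → P n
  from zero    b with P? 0
  from zero    b  | yes P0 = P0
  from zero    () | no _
  from (suc n) h′ = proj₂ rec h′

IsClosed : Vec Bool k → Set
IsClosed {k} v = 0 ∈ ⟦ v ⟧ × (∀ {x} → x < k → ∀ {y} → y < k → x ∈ ⟦ v ⟧ → y ∈ ⟦ v ⟧ → x + y ∈ ⟦ v ⟧)

isClosed? : Decidable (IsClosed {k})
isClosed? {k} v = ⟦ v ⟧? 0 ×-dec
  allUpTo? (λ x → allUpTo? (λ y → ⟦ v ⟧? x →-dec (⟦ v ⟧? y →-dec ⟦ v ⟧? (x + y))) k) k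

fromVec : (v : Vec Bool k) → IsClosed v → NumericalSemigroup
fromVec {k} v (0∈v , closed) = record
  { elements          = ⟦ v ⟧
  ; elements?         = ⟦ v ⟧?
  ; 0∈elements        = 0∈v
  ; +-closed          = λ {x} {y} → +-closed′ x y
  ; finite-complement = upTo k , λ {n} → complement n
  }
  where
  +-closed′ : ∀ x y → x ∈ ⟦ v ⟧ → y ∈ ⟦ v ⟧ → x + y ∈ ⟦ v ⟧
  +-closed′ x y x∈ y∈ with x <? k | y <? k
  ... | yes x<k | yes y<k = closed x<k y<k x∈ y∈
  ... | no x≮k  | _       = ⟦⟧-beyond v (≤-trans (≮⇒≥ x≮k) (m≤m+n x y))
  ... | yes _   | no y≮k  = ⟦⟧-beyond v (≤-trans (≮⇒≥ y≮k) (m≤n+m y x))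
  complement : ∀ n → n ∉ ⟦ v ⟧ → n ∈ₗ upTo k
  complement n n∉ with n <? k
  ... | yes n<k = Membershipₚ.∈-upTo⁺ n<k
  ... | no n≮k  = ⊥-elim (n∉ (⟦⟧-beyond v (≮⇒≥ n≮k)))

allVecs : ∀ k → List (Vec Bool k)
allVecs zero    = [] ∷ []
allVecs (suc k) = map (true ∷_) (allVecs k) ++ map (false ∷_) (allVecs k)

allVecs-complete : (v : Vec Bool k) → v ∈ₗ allVecs k
allVecs-complete []          = here refl
allVecs-complete (true ∷ v)  = Membershipₚ.∈-++⁺ˡ (Membershipₚ.∈-map⁺ (true ∷_) (allVecs-complete v))
allVecs-complete (false ∷ v) = Membershipₚ.∈-++⁺ʳ _ (Membershipₚ.∈-map⁺ (false ∷_) (allVecs-complete v))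

allVecs-unique : ∀ k → Propositional.Unique (allVecs k)
allVecs-unique zero    = [] ∷ []
allVecs-unique (suc k) = Propositionalₚ.++⁺
  (Propositionalₚ.map⁺ (λ where refl → refl) (allVecs-unique k))
  (Propositionalₚ.map⁺ (λ where refl → refl) (allVecs-unique k))
  λ (∈t , ∈f) → disjoint (Membershipₚ.∈-map⁻ (true ∷_) ∈t) (Membershipₚ.∈-map⁻ (false ∷_) ∈f)
  where
  disjoint : ∀ {v : Vec Bool (suc k)} {vs ws} →
             (∃ λ u → u ∈ₗ vs × v ≡ true ∷ u) → ¬ (∃ λ u → u ∈ₗ ws × v ≡ false ∷ u)
  disjoint (_ , _ , refl) (_ , _ , ())

closedOnes : List (Vec Bool k) → List NumericalSemigroup
closedOnes []       = []
closedOnes (v ∷ vs) with isClosed? v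
... | yes c = fromVec v c ∷ closedOnes vs
... | no  _ = closedOnes vs

open SetoidMembership semigroupSetoid using () renaming (_∈_ to _∈ₛ_)

closedOnes-complete : ∀ Λ {v : Vec Bool k} {vs} → elements Λ ≐ ⟦ v ⟧ → v ∈ₗ vs → Λ ∈ₛ closedOnes vs
closedOnes-complete Λ {v} (to , from) (here refl) with isClosed? v
... | yes _ = here (to , from)
... | no ¬c = ⊥-elim (¬c (to (0∈elements Λ) , λ _ _ x∈ y∈ → to (+-closed Λ (from x∈) (from y∈))))
closedOnes-complete Λ {vs = w ∷ _} e (there v∈) with isClosed? w
... | yes _ = there (closedOnes-complete Λ e v∈)
... | no  _ = closedOnes-complete Λ e v∈

closedOnes-unique : {vs : List (Vec Bool k)} → Propositional.Unique vs → SetoidUnique.Unique semigroupSetoid (closedOnes vs)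
closedOnes-unique []                        = []
closedOnes-unique {vs = v ∷ _} (v∉ ∷ uniq) with isClosed? v
... | yes _ = distinct v∉ ∷ closedOnes-unique uniq
  where
  distinct : ∀ {ws} → All (v ≢_) ws → All (λ Λ → ¬ (⟦ v ⟧ ≐ elements Λ)) (closedOnes ws)
  distinct []                      = []
  distinct {w ∷ _} (v≢w ∷ rest) with isClosed? w
  ... | yes _ = (λ e → v≢w (⟦⟧-injective v w e)) ∷ distinct rest
  ... | no  _ = distinct rest
... | no  _ = closedOnes-unique uniq

frobenius⇒conductor : ∀ Λ {f} → frobenius Λ ≡ + f → conductor Λ ≡ suc f
frobenius⇒conductor Λ eq with conductor Λ
frobenius⇒conductor Λ ()   | zero
frobenius⇒conductor Λ refl | suc c = refl

semigroups : ∀ f q → Enumeration semigroupSetoid (HasFrobeniusAndDepth f q)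
semigroups f q = record
  { list     = filter P? candidates
  ; sound    = all-filter P? candidates
  ; complete = λ {Λ} PΛ → SetoidMembershipₚ.∈-filter⁺ semigroupSetoid P? (λ {Λ} {Λ′} → hasFrobeniusAndDepth-resp f q {Λ} {Λ′})
                            {v = Λ} (closedOnes-complete Λ {characteristic (elements? Λ) (suc f)} (char Λ PΛ) (allVecs-complete _)) PΛ
  ; unique   = SetoidUniqueₚ.filter⁺ semigroupSetoid P? (closedOnes-unique (allVecs-unique (suc f)))
  }
  where
  P? = hasFrobeniusAndDepth? f q
  candidates = closedOnes (allVecs (suc f))
  char : ∀ Λ → HasFrobeniusAndDepth f q Λ → elements Λ ≐ ⟦ characteristic (elements? Λ) (suc f) ⟧
  char Λ (F , _) = characteristic-≐ (elements? Λ) (suc f)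
    (subst (ContainsFrom Λ) (frobenius⇒conductor Λ F) (proj₁ (conductor-isLeast Λ)))

fromℤ : ℤ → ℚ
fromℤ z = z ℚ./ 1

Near : ℕ → ℕ → ℚ → Pred NumericalSemigroup 0ℓ
Near f q ε Λ = ℚ.∣ fromℤ (+ f ℤ.- (+ q ℤ.- 1ℤ) ℤ.* + multiplicity Λ) ∣ ℚ.< ε ℚ.* fromℤ (+ f)

near? : ∀ f q ε → Decidable (Near f q ε)
near? f q ε Λ = _ ℚ.<? _

{-# OPTIONS --safe #-}
-- Write f = (q - 1) m + r with 0 < r < m, and T k for the largest product (x + 1)(y + 1) with x + y = k.
--
-- Upper bound for a given m.  Let D be the set of the d largest gaps, d a large constant.  An element n of
-- Λ makes all g - n with g ∈ D gaps.  Passing once through Λ and keeping only the elements that yield many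
-- new gaps in this way, a small subset X of Λ determines a set W of gaps such that every n ∈ Λ has g - n ∈ W
-- for all but few g ∈ D.  By averaging, some g ∈ D has only a small set E of exceptional n.  Given D, X, g
-- and E, all elements of Λ below g outside E lie in {n : n ∉ W, g - n ∈ W}, which contains at most one
-- element of each pair {n, g - n}; as Λ is closed under adding m, two classes i and g - i modulo m that meet
-- [0, g] in k elements each admit at most T k choices.  As small sets are subexponentially few, there are at
-- most T(q)^((r + 1)/2) T(q - 1)^((m - r - 1)/2) 2^(o(f)) semigroups.
--
-- Lower bound.  For the largest possible m, adding to the multiples of m and to (f, ∞) any subset of
-- (f/2, f) closed under adding m and avoiding the class of f gives T(q - 1)^(f/(2 (q - 1)) - O(1)) semigroups.
--
-- Since T(q)^(q - 1) < T(q - 1)^q for q ≥ 3, the former bound is exponentially smaller when r ≥ ε f.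
module Submission where

open import Defs
open import Data.Nat.Base using (ℕ; _≤_; NonZero)
open import Data.Product.Base using (Σ; ∃)

-- The relation between `n` and `f - n` alone would not do. If two opposite classes contain `x` and
-- `y` elements up to `f`, it gives `x + y ≤ k`, hence `(k + 1)(k + 2) / 2` choices, which over all
-- pairs exceeds the product of the `T k` exponentially. So `W` has to be fixed before the elements
-- are chosen: then it is the candidates in the two classes that number `x` and `y` with
-- `x + y ≤ k`, the choices are independent, and there are `(x + 1)(y + 1)` of them. For one
-- prescribed gap such as `f` there is no useful bound on the exceptional `n`; only their total over
-- `D` is controlled. Hence `D` has many elements, and it consists of the largest gaps so that,
-- whichever `g` is found, `D` also records `Λ` above `g`. All estimates stay in the natural
-- numbers: halved exponents are avoided by squaring, roots by raising to powers, and `1 + 1/b`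
-- appears as `suc b` against `b`.

module Counting where

  open import Data.Bool.Base using (Bool; true; false; _∧_; _∨_; not; if_then_else_)
  open import Data.Bool.Properties using (T-≡; T?; ∧-zeroʳ; not-involutive) renaming (_≟_ to _≟ᵇ_)
  import Data.Fin.Base as Fin
  open Fin using (Fin; zero; suc; toℕ; fromℕ<; remQuot; combine; finToFun; funToFin)
  open import Data.Fin.Properties using (injective⇒≤; toℕ<n; toℕ-injective; toℕ-fromℕ<; combine-remQuot; funToFin-finToFin)
  import Data.Integer.Base as ℤ
  open import Data.List.Base using (List; []; _∷_; _++_; map; length; lookup; filter; filterᵇ; applyUpTo; upTo; concatMap; cartesianProductWith)
  open import Data.List.Membership.Propositional using (_∈_; lose)
  open import Data.List.Membership.Propositional.Properties
  import Data.List.Membership.Setoid.Properties as SetoidMembershipₚ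
  open import Data.List.Properties using (length-map; length-++; length-filter; length-upTo)
  import Data.List.Relation.Unary.All as All
  open import Data.List.Relation.Unary.AllPairs using (_∷_)
  open import Data.List.Relation.Unary.Any using (here; there; index)
  import Data.List.Relation.Unary.Unique.Setoid as SetoidUnique
  open import Data.Nat.Base
  open import Data.Nat.Divisibility using (divides-refl)
  open import Data.Nat.DivMod
  open import Data.Nat.Properties
  open import Data.Nat.Tactic.RingSolver using (solve-∀)
  open import Data.Product.Base using (_×_; _,_; proj₁; proj₂)
  open import Data.Sum.Base using (_⊎_; inj₁; inj₂)
  open import Function.Base using (_∘_; id)
  open import Function.Bundles using (Equivalence)
  open import Level using (Level)
  open import Relation.Binary.Bundles using (Setoid)
  open import Relation.Binary.Definitions using (tri<; tri≈; tri>)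
  open import Relation.Binary.PropositionalEquality
  open import Relation.Nullary
  open import Relation.Nullary.Decidable using (_×-dec_; _⊎-dec_; dec-true; dec-false)
  open import Relation.Unary using (Decidable)

  -- Sums and products over ranges

  Σ< : ℕ → (ℕ → ℕ) → ℕ
  Σ< zero    u = 0
  Σ< (suc n) u = u 0 + Σ< n (u ∘ suc)

  Π< : ℕ → (ℕ → ℕ) → ℕ
  Π< zero    u = 1
  Π< (suc n) u = u 0 * Π< n (u ∘ suc)

  𝟙 : Bool → ℕ
  𝟙 true  = 1
  𝟙 false = 0

  Σ<-mono : ∀ n {u v} → (∀ i → i < n → u i ≤ v i) → Σ< n u ≤ Σ< n v
  Σ<-mono zero    h = z≤n
  Σ<-mono (suc n) h = +-mono-≤ (h 0 z<s) (Σ<-mono n (λ i i<n → h (suc i) (s<s i<n)))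

  Σ<-cong : ∀ n {u v} → (∀ i → i < n → u i ≡ v i) → Σ< n u ≡ Σ< n v
  Σ<-cong zero    h = refl
  Σ<-cong (suc n) h = cong₂ _+_ (h 0 z<s) (Σ<-cong n (λ i i<n → h (suc i) (s<s i<n)))

  Σ<-snoc : ∀ n u → Σ< (suc n) u ≡ Σ< n u + u n
  Σ<-snoc zero    u = +-comm (u 0) 0
  Σ<-snoc (suc n) u = trans (cong (u 0 +_) (Σ<-snoc n (u ∘ suc))) (sym (+-assoc (u 0) _ _))

  Σ<-const : ∀ n c → Σ< n (λ _ → c) ≡ n * c
  Σ<-const zero    c = refl
  Σ<-const (suc n) c = cong (c +_) (Σ<-const n c)

  Σ<-+ : ∀ n u v → Σ< n (λ i → u i + v i) ≡ Σ< n u + Σ< n v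
  Σ<-+ zero    u v = refl
  Σ<-+ (suc n) u v rewrite Σ<-+ n (u ∘ suc) (v ∘ suc) = interchange (u 0) (v 0) _ _
    where
    interchange : ∀ a b c d → a + b + (c + d) ≡ a + c + (b + d)
    interchange = solve-∀

  Σ<-*ˡ : ∀ n c u → Σ< n (λ i → c * u i) ≡ c * Σ< n u
  Σ<-*ˡ zero    c u = sym (*-zeroʳ c)
  Σ<-*ˡ (suc n) c u = trans (cong (c * u 0 +_) (Σ<-*ˡ n c (u ∘ suc))) (sym (*-distribˡ-+ c (u 0) _))

  Σ<-swap : ∀ m n (u : ℕ → ℕ → ℕ) → Σ< m (λ i → Σ< n (u i)) ≡ Σ< n (λ j → Σ< m (λ i → u i j))
  Σ<-swap zero    n u = sym (trans (Σ<-const n 0) (*-zeroʳ n))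
  Σ<-swap (suc m) n u = trans (cong (Σ< n (u 0) +_) (Σ<-swap m n (u ∘ suc))) (sym (Σ<-+ n (u 0) _))

  Σ<-split : ∀ m n u → Σ< (m + n) u ≡ Σ< m u + Σ< n (λ i → u (m + i))
  Σ<-split zero    n u = refl
  Σ<-split (suc m) n u = trans (cong (u 0 +_) (Σ<-split m n (u ∘ suc))) (sym (+-assoc (u 0) _ _))

  Σ<-support : ∀ m n u → (∀ i → n ≤ i → u i ≡ 0) → Σ< m u ≤ Σ< n u
  Σ<-support zero    n       u h = z≤n
  Σ<-support (suc m) zero    u h = ≤-reflexive (cong₂ _+_ (h 0 z≤n) (n≤0⇒n≡0 (Σ<-support m 0 (u ∘ suc) (λ i _ → h (suc i) z≤n))))
  Σ<-support (suc m) (suc n) u h = +-monoʳ-≤ (u 0) (Σ<-support m n (u ∘ suc) (λ i n≤i → h (suc i) (s≤s n≤i)))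

  Σ<-residues : ∀ m k u → Σ< m (λ i → Σ< k (λ a → u (i + a * m))) ≡ Σ< (k * m) u
  Σ<-residues m k u = trans (Σ<-swap m k (λ i a → u (i + a * m))) (blocks k u)
    where
    shift : ∀ i a m → i + (m + a * m) ≡ m + (i + a * m)
    shift = solve-∀
    blocks : ∀ k u → Σ< k (λ a → Σ< m (λ i → u (i + a * m))) ≡ Σ< (k * m) u
    blocks zero    u = refl
    blocks (suc k) u = trans
      (cong₂ _+_
        (Σ<-cong m (λ i _ → cong u (+-identityʳ i)))
        (trans (Σ<-cong k (λ a _ → Σ<-cong m (λ i _ → cong u (shift i a m)))) (blocks k (λ n → u (m + n)))))
      (sym (Σ<-split m (k * m) u))

  -- The substitution `i = j + n`. The hypothesis removes the terms with `i < n`, where `∸`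
  -- truncates; the range of `j` is longer than needed, hence `≤`.
  Σ<-shift : ∀ n k (u : ℕ → ℕ → ℕ) → (∀ {i} → i < n → ∀ j → u i j ≡ 0) →
             Σ< k (λ i → u i (i ∸ n)) ≤ Σ< k (λ j → u (j + n) j)
  Σ<-shift zero    k       u h = ≤-reflexive (Σ<-cong k (λ i _ → cong (λ j → u j i) (sym (+-identityʳ i))))
  Σ<-shift (suc n) zero    u h = z≤n
  Σ<-shift (suc n) (suc k) u h = begin
    u 0 0 + Σ< k (λ i → u (suc i) (i ∸ n))            ≡⟨ cong (_+ Σ< k (λ i → u (suc i) (i ∸ n))) (h z<s 0) ⟩
    Σ< k (λ i → u (suc i) (i ∸ n))                    ≤⟨ Σ<-shift n k (u ∘ suc) (λ i<n → h (s<s i<n)) ⟩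
    Σ< k (λ j → u (suc (j + n)) j)                    ≡⟨ Σ<-cong k (λ j _ → cong (λ i → u i j) (sym (+-suc j n))) ⟩
    Σ< k (λ j → u (j + suc n) j)                      ≤⟨ m≤m+n _ _ ⟩
    Σ< k (λ j → u (j + suc n) j) + u (k + suc n) k    ≡⟨ Σ<-snoc k (λ j → u (j + suc n) j) ⟨
    Σ< (suc k) (λ j → u (j + suc n) j)                ∎
    where open ≤-Reasoning

  Σ<-mirror : ∀ n c u v → (∀ i j → suc (i + j) ≡ n → u i + v j ≤ c) → Σ< n u + Σ< n v ≤ n * c
  Σ<-mirror zero    c u v h = z≤n
  Σ<-mirror (suc n) c u v h = begin
    u 0 + Σ< n (u ∘ suc) + Σ< (suc n) v       ≡⟨ cong (u 0 + Σ< n (u ∘ suc) +_) (Σ<-snoc n v) ⟩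
    u 0 + Σ< n (u ∘ suc) + (Σ< n v + v n)     ≡⟨ regroup (u 0) _ _ (v n) ⟩
    (u 0 + v n) + (Σ< n (u ∘ suc) + Σ< n v)   ≤⟨ +-mono-≤ (h 0 n refl) (Σ<-mirror n c (u ∘ suc) v (λ i j e → h (suc i) j (cong suc e))) ⟩
    c + n * c                                 ∎
    where
    open ≤-Reasoning
    regroup : ∀ a b c d → a + b + (c + d) ≡ a + d + (b + c)
    regroup = solve-∀

  Π<-snoc : ∀ n u → Π< (suc n) u ≡ Π< n u * u n
  Π<-snoc zero    u = *-comm (u 0) 1
  Π<-snoc (suc n) u = trans (cong (u 0 *_) (Π<-snoc n (u ∘ suc))) (sym (*-assoc (u 0) _ _))

  Π<-split : ∀ m n u → Π< (m + n) u ≡ Π< m u * Π< n (λ i → u (m + i))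
  Π<-split zero    n u = sym (+-identityʳ _)
  Π<-split (suc m) n u = trans (cong (u 0 *_) (Π<-split m n (u ∘ suc))) (sym (*-assoc (u 0) _ _))

  Π<-mono : ∀ n {u v} → (∀ i → i < n → u i ≤ v i) → Π< n u ≤ Π< n v
  Π<-mono zero    h = ≤-refl
  Π<-mono (suc n) h = *-mono-≤ (h 0 z<s) (Π<-mono n (λ i i<n → h (suc i) (s<s i<n)))

  Π<-* : ∀ n u v → Π< n (λ i → u i * v i) ≡ Π< n u * Π< n v
  Π<-* zero    u v = refl
  Π<-* (suc n) u v rewrite Π<-* n (u ∘ suc) (v ∘ suc) = [m*n]*[o*p]≡[m*o]*[n*p] (u 0) (v 0) _ _

  Π<-^ : ∀ n c u → Π< n (λ i → c ^ u i) ≡ c ^ Σ< n u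
  Π<-^ zero    c u = refl
  Π<-^ (suc n) c u = trans (cong (c ^ u 0 *_) (Π<-^ n c (u ∘ suc))) (sym (^-distribˡ-+-* c (u 0) _))

  -- Used with `u = v`: in the square of a product every factor meets its mirror image, so neither
  -- the parity of `n` nor a self-paired middle factor needs a separate treatment.
  Π<-mirror : ∀ n c u v → (∀ i j → suc (i + j) ≡ n → u i * v j ≤ c) → Π< n u * Π< n v ≤ c ^ n
  Π<-mirror zero    c u v h = ≤-refl
  Π<-mirror (suc n) c u v h = begin
    u 0 * Π< n (u ∘ suc) * Π< (suc n) v       ≡⟨ cong (u 0 * Π< n (u ∘ suc) *_) (Π<-snoc n v) ⟩
    u 0 * Π< n (u ∘ suc) * (Π< n v * v n)     ≡⟨ regroup (u 0) _ _ (v n) ⟩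
    (u 0 * v n) * (Π< n (u ∘ suc) * Π< n v)   ≤⟨ *-mono-≤ (h 0 n refl) (Π<-mirror n c (u ∘ suc) v (λ i j e → h (suc i) j (cong suc e))) ⟩
    c * c ^ n                                 ∎
    where
    open ≤-Reasoning
    regroup : ∀ a b c d → a * b * (c * d) ≡ a * d * (b * c)
    regroup = solve-∀

  -- Bernoulli's inequality and a converse, without denominators

  bernoulli : ∀ b n → (b + n) * b ^ n ≤ b * suc b ^ n
  bernoulli b zero    = ≤-reflexive (cong (_* 1) (+-identityʳ b))
  bernoulli b (suc n) = begin
    (b + suc n) * (b * b ^ n)                ≤⟨ m≤m+n _ (n * b ^ n) ⟩
    (b + suc n) * (b * b ^ n) + n * b ^ n    ≡⟨ expand b n (b ^ n) ⟩
    suc b * ((b + n) * b ^ n)                ≤⟨ *-monoʳ-≤ (suc b) (bernoulli b n) ⟩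
    suc b * (b * suc b ^ n)                  ≡⟨ swap b (suc b ^ n) ⟩
    b * (suc b * suc b ^ n)                  ∎
    where
    open ≤-Reasoning
    expand : ∀ b n x → (b + suc n) * (b * x) + n * x ≡ suc b * ((b + n) * x)
    expand = solve-∀
    swap : ∀ b x → suc b * (b * x) ≡ b * (suc b * x)
    swap = solve-∀

  -- (1 + 1/b)ʲ ≤ 1/(1 - j/b) for b = j + c, with a slack that makes it strict.
  reverse-bernoulli : ∀ j c → suc (j + c) ^ j * c + j ≤ (j + c) ^ suc j
  reverse-bernoulli zero    c = ≤-reflexive (trans (+-identityʳ _) (*-comm 1 c))
  reverse-bernoulli (suc j) c = begin
    suc b * suc b ^ j * c + suc j                  ≡⟨ cong (_+ suc j) (rearrange (suc b) (suc b ^ j) c) ⟩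
    suc b ^ j * (suc b * c) + suc j                ≤⟨ +-monoʳ-≤ (suc b ^ j * (suc b * c)) (m≤n*m (suc j) (suc b ^ j) {{m^n≢0 (suc b) j}}) ⟩
    suc b ^ j * (suc b * c) + suc b ^ j * suc j    ≡⟨ expand j c (suc b ^ j) ⟩
    suc b ^ j * suc c * b                          ≡⟨ cong (λ x → suc x ^ j * suc c * b) (+-suc j c) ⟨
    -- The induction hypothesis is taken at `suc c`, which keeps `b` unchanged.
    suc (j + suc c) ^ j * suc c * b                ≤⟨ *-monoˡ-≤ b (≤-trans (m≤m+n _ j) (reverse-bernoulli j (suc c))) ⟩
    (j + suc c) ^ suc j * b                        ≡⟨ cong (λ x → x ^ suc j * b) (+-suc j c) ⟩
    b ^ suc j * b                                  ≡⟨ *-comm (b ^ suc j) b ⟩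
    b ^ suc (suc j)                                ∎
    where
    open ≤-Reasoning
    b = suc j + c
    rearrange : ∀ a x c → a * x * c ≡ x * (a * c)
    rearrange = solve-∀
    expand : ∀ j c x → x * (suc (suc j + c) * c) + x * suc j ≡ x * suc c * (suc j + c)
    expand = solve-∀

  -- Growth of the largest products `T`

  T : ℕ → ℕ
  T k = suc ⌊ k /2⌋ * suc ⌈ k /2⌉

  [2+x]*[2+y] : ∀ x y → suc (suc x) * suc (suc y) ≡ suc x * suc y + (3 + (x + y))
  [2+x]*[2+y] = solve-∀

  T-step : ∀ k → T (2 + k) ≡ T k + (3 + k)
  T-step k = trans ([2+x]*[2+y] ⌊ k /2⌋ ⌈ k /2⌉) (cong (λ s → T k + (3 + s)) (⌊n/2⌋+⌈n/2⌉≡n k))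

  suc≤T : ∀ k → suc k ≤ T k
  suc≤T zero          = ≤-refl
  suc≤T (suc zero)    = ≤-refl
  suc≤T (suc (suc k)) = ≤-trans (m≤n+m _ (T k)) (≤-reflexive (sym (T-step k)))

  -- Lowering both factors by one lowers the product by `3 + (x + y)` and the bound by `3 + k`,
  -- where `x` and `y` are the lowered values and `k` is lowered by two. This leaves only the case
  -- where one factor is 1.
  suc*suc≤T : ∀ x y k → x + y ≤ k → suc x * suc y ≤ T k
  suc*suc≤T zero    y       k             y≤k = ≤-trans (≤-reflexive (+-identityʳ _)) (≤-trans (s≤s y≤k) (suc≤T k))
  suc*suc≤T (suc x) zero    k             x≤k = ≤-trans (≤-reflexive (*-identityʳ _)) (≤-trans (s≤s (≤-trans (m≤m+n _ 0) x≤k)) (suc≤T k))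
  suc*suc≤T (suc x) (suc y) k x+y≤k with ≤-trans (≤-reflexive (cong suc (sym (+-suc x y)))) x+y≤k
  ... | s≤s (s≤s {n = k′} x+y≤k′) = begin
    suc (suc x) * suc (suc y)        ≡⟨ [2+x]*[2+y] x y ⟩
    suc x * suc y + (3 + (x + y))    ≤⟨ +-mono-≤ (suc*suc≤T x y k′ x+y≤k′) (+-monoʳ-≤ 3 x+y≤k′) ⟩
    T k′ + (3 + k′)                  ≡⟨ T-step k′ ⟨
    T (2 + k′)                       ∎
    where open ≤-Reasoning

  T-mono : ∀ {j k} → j ≤ k → T j ≤ T k
  T-mono {j} {k} j≤k = suc*suc≤T ⌊ j /2⌋ ⌈ j /2⌉ k (≤-trans (≤-reflexive (⌊n/2⌋+⌈n/2⌉≡n j)) j≤k)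

  even⊎odd : ∀ p → ∃ λ j → p ≡ j + j ⊎ p ≡ suc (j + j)
  even⊎odd zero    = 0 , inj₁ refl
  even⊎odd (suc p) with even⊎odd p
  ... | j , inj₁ refl = j , inj₂ refl
  ... | j , inj₂ refl = suc j , inj₁ (cong suc (sym (+-suc j j)))

  T[j+j] : ∀ j → T (j + j) ≡ suc j * suc j
  T[j+j] j = sym (cong₂ (λ x y → suc x * suc y) (n≡⌊n+n/2⌋ j) (n≡⌈n+n/2⌉ j))

  T[1+j+j] : ∀ j → T (suc (j + j)) ≡ suc j * suc (suc j)
  T[1+j+j] j = sym (cong₂ (λ x y → suc x * suc (suc y)) (n≡⌈n+n/2⌉ j) (n≡⌊n+n/2⌋ j))

  -- The case `c = 1` of `reverse-bernoulli`, strict because of the slack `j`. For `p = 2 j` and for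
  -- `p = 2 j + 1` alike, `T-growth` becomes the square of this inequality after cancellation.
  [2+j]^j<[1+j]^[1+j] : ∀ j → 1 ≤ j → (2 + j) ^ j < suc j * suc j ^ j
  [2+j]^j<[1+j]^[1+j] j 1≤j = begin-strict
    (2 + j) ^ j                ≡⟨ *-identityʳ _ ⟨
    (2 + j) ^ j * 1            <⟨ m<m+n _ 1≤j ⟩
    (2 + j) ^ j * 1 + j        ≡⟨ cong (λ x → suc x ^ j * 1 + j) (+-comm 1 j) ⟩
    suc (j + 1) ^ j * 1 + j    ≤⟨ reverse-bernoulli j 1 ⟩
    (j + 1) ^ suc j            ≡⟨ cong (_^ suc j) (+-comm j 1) ⟩
    suc j ^ suc j              ∎
    where open ≤-Reasoning

  ^-distribʳ-* : ∀ n x y → (x * y) ^ n ≡ x ^ n * y ^ n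
  ^-distribʳ-* zero    x y = refl
  ^-distribʳ-* (suc n) x y = trans (cong (x * y *_) (^-distribʳ-* n x y)) ([m*n]*[o*p]≡[m*o]*[n*p] x y (x ^ n) (y ^ n))

  ^-swap : ∀ x k l → (x ^ k) ^ l ≡ (x ^ l) ^ k
  ^-swap x k l = trans (^-*-assoc x k l) (trans (cong (x ^_) (*-comm k l)) (sym (^-*-assoc x l k)))

  [x*y]^[j+j] : ∀ x y j → (x * y) ^ (j + j) ≡ (x ^ j * y ^ j) * (x ^ j * y ^ j)
  [x*y]^[j+j] x y j = trans (^-distribˡ-+-* (x * y) j j) (cong (λ z → z * z) (^-distribʳ-* j x y))

  -- Fails for p = 1, where both sides are 4: this is where depth 2 has to be excluded.
  T-growth : ∀ p → 2 ≤ p → T (suc p) ^ p < T p ^ suc p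
  T-growth p 2≤p with even⊎odd p
  ... | zero , inj₁ refl = contradiction 2≤p λ ()
  ... | zero , inj₂ refl = contradiction 2≤p λ { (s≤s ()) }
  ... | j@(suc _) , inj₁ refl = begin-strict
    T (suc (j + j)) ^ (j + j)            ≡⟨ cong (_^ (j + j)) (T[1+j+j] j) ⟩
    (k * suc k) ^ (j + j)                ≡⟨ [x*y]^[j+j] k (suc k) j ⟩
    (C * A) * (C * A)                    <⟨ *-mono-< CA< CA< ⟩
    (C * (k * C)) * (C * (k * C))        ≡⟨ regroup k C ⟩
    k * k * ((C * C) * (C * C))          ≡⟨ cong (k * k *_) ([x*y]^[j+j] k k j) ⟨
    (k * k) ^ suc (j + j)                ≡⟨ cong (_^ suc (j + j)) (T[j+j] j) ⟨
    T (j + j) ^ suc (j + j)              ∎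
    where
    open ≤-Reasoning
    k = suc j
    A = suc k ^ j
    C = k ^ j
    CA< : C * A < C * (k * C)
    CA< = *-monoʳ-< C {{m^n≢0 k j}} ([2+j]^j<[1+j]^[1+j] j z<s)
    regroup : ∀ k C → (C * (k * C)) * (C * (k * C)) ≡ k * k * ((C * C) * (C * C))
    regroup = solve-∀
  ... | j@(suc _) , inj₂ refl = begin-strict
    T (2 + (j + j)) ^ suc (j + j)                      ≡⟨ cong (λ x → T (suc x) ^ suc (j + j)) (+-suc j j) ⟨
    T (suc j + suc j) ^ suc (j + j)                    ≡⟨ cong (_^ suc (j + j)) (T[j+j] (suc j)) ⟩
    (suc k * suc k) ^ suc (j + j)                      ≡⟨ cong (suc k * suc k *_) ([x*y]^[j+j] (suc k) (suc k) j) ⟩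
    suc k * suc k * ((A * A) * (A * A))                ≡⟨ regroup₁ (suc k) A ⟩
    (suc k * A * A) * (suc k * A * A)                  <⟨ *-mono-< AA< AA< ⟩
    (suc k * A * (k * C)) * (suc k * A * (k * C))      ≡⟨ regroup₂ k (suc k) A C ⟩
    k * suc k * (k * suc k * ((C * A) * (C * A)))      ≡⟨ cong (λ x → k * suc k * (k * suc k * x)) ([x*y]^[j+j] k (suc k) j) ⟨
    (k * suc k) ^ suc (suc (j + j))                    ≡⟨ cong (_^ suc (suc (j + j))) (T[1+j+j] j) ⟨
    T (suc (j + j)) ^ suc (suc (j + j))                ∎
    where
    open ≤-Reasoning
    k = suc j
    A = suc k ^ j
    C = k ^ j
    AA< : suc k * A * A < suc k * A * (k * C)
    AA< = *-monoʳ-< (suc k * A) {{m*n≢0 (suc k) A {{_}} {{m^n≢0 (suc k) j}}}} ([2+j]^j<[1+j]^[1+j] j z<s)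
    regroup₁ : ∀ k A → k * k * ((A * A) * (A * A)) ≡ (k * A * A) * (k * A * A)
    regroup₁ = solve-∀
    regroup₂ : ∀ k l A C → (l * A * (k * C)) * (l * A * (k * C)) ≡ k * l * (k * l * ((C * A) * (C * A)))
    regroup₂ = solve-∀

  -- Subexponential factors

  exponential-wins : ∀ u v c .{{_ : NonZero u}} → u < v → ∀ n → c * u ≤ n → c * u ^ n ≤ v ^ n
  exponential-wins u v c u<v n cu≤n = *-cancelˡ-≤ u (begin
    u * (c * u ^ n)     ≡⟨ regroup u c (u ^ n) ⟩
    c * u * u ^ n       ≤⟨ *-monoˡ-≤ (u ^ n) (≤-trans cu≤n (m≤n+m n u)) ⟩
    (u + n) * u ^ n     ≤⟨ bernoulli u n ⟩
    u * suc u ^ n       ≤⟨ *-monoʳ-≤ u (^-monoˡ-≤ n u<v) ⟩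
    u * v ^ n           ∎)
    where
    open ≤-Reasoning
    regroup : ∀ u c x → u * (c * x) ≡ c * u * x
    regroup = solve-∀

  b*b^[b*b]≤[1+b]^[b*b] : ∀ b .{{_ : NonZero b}} → b * b ^ (b * b) ≤ suc b ^ (b * b)
  b*b^[b*b]≤[1+b]^[b*b] b = *-cancelˡ-≤ b (begin
    b * (b * b ^ (b * b))          ≡⟨ *-assoc b b _ ⟨
    b * b * b ^ (b * b)            ≤⟨ *-monoˡ-≤ (b ^ (b * b)) (m≤n+m (b * b) b) ⟩
    (b + b * b) * b ^ (b * b)      ≤⟨ bernoulli b (b * b) ⟩
    b * suc b ^ (b * b)            ∎)
    where open ≤-Reasoning

  -- Replacing `b` by `suc b` gains a factor of at least `b` on each of `s` blocks of `b * b`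
  -- exponents, by Bernoulli, and loses nothing on the remaining `t`.
  b^s*b^n≤[1+b]^n : ∀ b .{{_ : NonZero b}} s n → s * (b * b) ≤ n → b ^ s * b ^ n ≤ suc b ^ n
  b^s*b^n≤[1+b]^n b s n sν≤n = begin
    b ^ s * b ^ n                               ≡⟨ cong (λ x → b ^ s * b ^ x) (m+[n∸m]≡n sν≤n) ⟨
    b ^ s * b ^ (s * ν + t)                     ≡⟨ cong (b ^ s *_) (^-distribˡ-+-* b (s * ν) t) ⟩
    b ^ s * (b ^ (s * ν) * b ^ t)               ≡⟨ *-assoc (b ^ s) _ _ ⟨
    b ^ s * b ^ (s * ν) * b ^ t                 ≡⟨ cong (λ x → b ^ s * b ^ x * b ^ t) (*-comm s ν) ⟩
    b ^ s * b ^ (ν * s) * b ^ t                 ≡⟨ cong (λ x → b ^ s * x * b ^ t) (^-*-assoc b ν s) ⟨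
    b ^ s * (b ^ ν) ^ s * b ^ t                 ≡⟨ cong (_* b ^ t) (^-distribʳ-* s b (b ^ ν)) ⟨
    (b * b ^ ν) ^ s * b ^ t                     ≤⟨ *-mono-≤ (^-monoˡ-≤ s (b*b^[b*b]≤[1+b]^[b*b] b)) (^-monoˡ-≤ t (n≤1+n b)) ⟩
    (suc b ^ ν) ^ s * suc b ^ t                 ≡⟨ cong (_* suc b ^ t) (^-*-assoc (suc b) ν s) ⟩
    suc b ^ (ν * s) * suc b ^ t                 ≡⟨ cong (λ x → suc b ^ x * suc b ^ t) (*-comm ν s) ⟩
    suc b ^ (s * ν) * suc b ^ t                 ≡⟨ ^-distribˡ-+-* (suc b) (s * ν) t ⟨
    suc b ^ (s * ν + t)                         ≡⟨ cong (suc b ^_) (m+[n∸m]≡n sν≤n) ⟩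
    suc b ^ n                                   ∎
    where
    open ≤-Reasoning
    ν = b * b
    t = n ∸ s * ν

  -- S stands for the number of subsets of {0, ..., n - 1} with at most s elements.
  subexponential : ∀ K e C P Q .{{_ : NonZero P}} → P < Q →
    ∃ λ ν → NonZero ν × ∃ λ n₀ → ∀ n → n₀ ≤ n → ∀ s S → s * ν ≤ n →
    (∀ b .{{_ : NonZero b}} → b ^ n * S ≤ b ^ s * suc b ^ n) →
    (K * (n * n) * (S * S * S) * 2 ^ s) ^ e * C * P ^ n ≤ Q ^ n
  subexponential K e C P Q P<Q = b * b , _ , (c″ * u) , bound
    where
    -- `Y≤` spends nine factors `(1 + 1/b)ⁿ`: two on `n * n`, two on each of the three copies of
    -- `S`, and one on `2 ^ s`.
    E = 9 * e
    -- As `c > E * P`, `reverse-bernoulli` gives `(1 + 1/b)ᴱ ≤ b / c < Q / P`, which is `u < v`. The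
    -- summand 2 ensures `2 ≤ b`, so that `2 ^ s ≤ b ^ s`.
    c = 2 + E * P
    b = c + E
    u = suc b ^ E * P
    v = b ^ E * Q
    c″ = (K * (b * b)) ^ e * C

    instance
      _ : NonZero (suc b ^ E * P)
      _ = m*n≢0 (suc b ^ E) P {{m^n≢0 (suc b) E}}

    u<v : u < v
    u<v = *-cancelʳ-< c u v (begin-strict
      suc b ^ E * P * c            ≡⟨ regroup (suc b ^ E) P c ⟩
      suc b ^ E * c * P            ≡⟨ cong (λ x → suc x ^ E * c * P) (+-comm c E) ⟩
      suc (E + c) ^ E * c * P      ≤⟨ *-monoˡ-≤ P (≤-trans (m≤m+n (suc (E + c) ^ E * c) E) (reverse-bernoulli E c)) ⟩
      (E + c) ^ suc E * P          ≡⟨ cong (λ x → x ^ suc E * P) (+-comm E c) ⟩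
      b * b ^ E * P                ≡⟨ regroup′ b (b ^ E) P ⟩
      b ^ E * (b * P)              <⟨ *-monoʳ-< (b ^ E) {{m^n≢0 b E}} bP<cQ ⟩
      b ^ E * (Q * c)              ≡⟨ *-assoc (b ^ E) Q c ⟨
      b ^ E * Q * c                ∎)
      where
      open ≤-Reasoning
      regroup : ∀ x y z → x * y * z ≡ x * z * y
      regroup = solve-∀
      regroup′ : ∀ x y z → x * y * z ≡ y * (x * z)
      regroup′ = solve-∀
      bP<cQ : b * P < Q * c
      bP<cQ = begin-strict
        (c + E) * P          ≡⟨ *-distribʳ-+ P c E ⟩
        c * P + E * P        <⟨ +-monoʳ-< (c * P) (m<n+m (E * P) z<s) ⟩
        c * P + c            ≡⟨ rearrange c P ⟩
        suc P * c            ≤⟨ *-monoˡ-≤ c P<Q ⟩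
        Q * c                ∎
        where
        rearrange : ∀ c P → c * P + c ≡ suc P * c
        rearrange = solve-∀

    bound : ∀ n → c″ * u ≤ n → ∀ s S → s * (b * b) ≤ n → (∀ b .{{_ : NonZero b}} → b ^ n * S ≤ b ^ s * suc b ^ n) →
            (K * (n * n) * (S * S * S) * 2 ^ s) ^ e * C * P ^ n ≤ Q ^ n
    bound n n₀≤n s S sν≤n count = *-cancelˡ-≤ (β ^ E) {{m^n≢0 β E {{m^n≢0 b n}}}} (begin
      β ^ E * (Y ^ e * C * P ^ n)            ≡⟨ cong (_* (Y ^ e * C * P ^ n)) (^-*-assoc β 9 e) ⟨
      (β ^ 9) ^ e * (Y ^ e * C * P ^ n)      ≡⟨ regroup₁ ((β ^ 9) ^ e) (Y ^ e) C (P ^ n) ⟩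
      (β ^ 9) ^ e * Y ^ e * (C * P ^ n)      ≡⟨ cong (_* (C * P ^ n)) (^-distribʳ-* e (β ^ 9) Y) ⟨
      (β ^ 9 * Y) ^ e * (C * P ^ n)          ≤⟨ *-monoˡ-≤ (C * P ^ n) (^-monoˡ-≤ e Y≤) ⟩
      (Kb * γ ^ 9) ^ e * (C * P ^ n)         ≡⟨ cong (_* (C * P ^ n)) (^-distribʳ-* e Kb (γ ^ 9)) ⟩
      Kb ^ e * (γ ^ 9) ^ e * (C * P ^ n)     ≡⟨ cong (λ x → Kb ^ e * x * (C * P ^ n)) (trans (^-*-assoc γ 9 e) (^-swap (suc b) n E)) ⟩
      Kb ^ e * (suc b ^ E) ^ n * (C * P ^ n) ≡⟨ [m*n]*[o*p]≡[m*o]*[n*p] (Kb ^ e) _ C _ ⟩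
      c″ * ((suc b ^ E) ^ n * P ^ n)         ≡⟨ cong (c″ *_) (^-distribʳ-* n (suc b ^ E) P) ⟨
      c″ * u ^ n                             ≤⟨ exponential-wins u v c″ u<v n n₀≤n ⟩
      v ^ n                                  ≡⟨ ^-distribʳ-* n (b ^ E) Q ⟩
      (b ^ E) ^ n * Q ^ n                    ≡⟨ cong (_* Q ^ n) (^-swap b n E) ⟨
      β ^ E * Q ^ n                          ∎)
      where
      open ≤-Reasoning
      β = b ^ n
      γ = suc b ^ n
      Y = K * (n * n) * (S * S * S) * 2 ^ s
      Kb = K * (b * b)
      regroup₁ : ∀ a y c p → a * (y * c * p) ≡ a * y * (c * p)
      regroup₁ = solve-∀
      nβ≤ : n * β ≤ b * γ
      nβ≤ = ≤-trans (*-monoˡ-≤ β (m≤n+m n b)) (bernoulli b n)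
      bˢβ≤ : b ^ s * β ≤ γ
      bˢβ≤ = b^s*b^n≤[1+b]^n b s n sν≤n
      2ˢβ≤ : 2 ^ s * β ≤ γ
      2ˢβ≤ = ≤-trans (*-monoˡ-≤ β (^-monoˡ-≤ s (m≤m+n 2 (E * P + E)))) bˢβ≤
      ββS≤ : β * (β * S) ≤ γ * γ
      ββS≤ = begin
        β * (β * S)          ≤⟨ *-monoʳ-≤ β (count b) ⟩
        β * (b ^ s * γ)      ≡⟨ regroup₂ β (b ^ s) γ ⟩
        b ^ s * β * γ        ≤⟨ *-monoˡ-≤ γ bˢβ≤ ⟩
        γ * γ                ∎
        where
        regroup₂ : ∀ x y z → x * (y * z) ≡ y * x * z
        regroup₂ = solve-∀
      Y≤ : β ^ 9 * Y ≤ Kb * γ ^ 9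
      Y≤ = begin
        β ^ 9 * Y                                                                          ≡⟨ split β K n S (2 ^ s) ⟩
        K * ((n * β) * (n * β)) * ((β * (β * S)) * (β * (β * S)) * (β * (β * S))) * (2 ^ s * β)
          ≤⟨ *-mono-≤ (*-mono-≤ (*-monoʳ-≤ K (*-mono-≤ nβ≤ nβ≤)) (*-mono-≤ (*-mono-≤ ββS≤ ββS≤) ββS≤)) 2ˢβ≤ ⟩
        K * ((b * γ) * (b * γ)) * ((γ * γ) * (γ * γ) * (γ * γ)) * γ                        ≡⟨ join K b γ ⟩
        Kb * γ ^ 9                                                                         ∎
        where
        split : ∀ β K n S t → (β * (β * (β * (β * (β * (β * (β * (β * (β * 1))))))))) * (K * (n * n) * (S * S * S) * t) ≡
                K * ((n * β) * (n * β)) * ((β * (β * S)) * (β * (β * S)) * (β * (β * S))) * (t * β)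
        split = solve-∀
        join : ∀ K b γ → K * ((b * γ) * (b * γ)) * ((γ * γ) * (γ * γ) * (γ * γ)) * γ ≡ K * (b * b) * (γ * (γ * (γ * (γ * (γ * (γ * (γ * (γ * (γ * 1)))))))))
        join = solve-∀

  -- Small subsets and fingerprints

  private
    variable
      ℓ : Level
      A B : Set ℓ

  at : A → List A → ℕ → A
  at d []       n       = d
  at d (x ∷ xs) zero    = x
  at d (x ∷ xs) (suc n) = at d xs n

  at-applyUpTo : ∀ (d : A) u {k n} → n < k → at d (applyUpTo u k) n ≡ u n
  at-applyUpTo d u {suc k} {zero}  _         = refl
  at-applyUpTo d u {suc k} {suc n} (s<s n<k) = at-applyUpTo d (u ∘ suc) n<k

  at-applyUpTo-≥ : ∀ (d : A) u {k n} → k ≤ n → at d (applyUpTo u k) n ≡ d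
  at-applyUpTo-≥ d u {zero}          _         = refl
  at-applyUpTo-≥ d u {suc k} {suc n} (s≤s k≤n) = at-applyUpTo-≥ d (u ∘ suc) k≤n

  length-filterᵇ-applyUpTo : ∀ (p : A → Bool) u k → length (filterᵇ p (applyUpTo u k)) ≡ Σ< k (λ i → 𝟙 (p (u i)))
  length-filterᵇ-applyUpTo p u zero    = refl
  length-filterᵇ-applyUpTo p u (suc k) with p (u 0)
  ... | true  = cong suc (length-filterᵇ-applyUpTo p (u ∘ suc) k)
  ... | false = length-filterᵇ-applyUpTo p (u ∘ suc) k

  length-concatMap-≤ : ∀ k c (u : A → List B) xs → (∀ {x} → x ∈ xs → k * length (u x) ≤ c) → k * length (concatMap u xs) ≤ length xs * c
  length-concatMap-≤ k c u []       h = ≤-reflexive (*-zeroʳ k)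
  length-concatMap-≤ k c u (x ∷ xs) h = begin
    k * length (u x ++ concatMap u xs)                ≡⟨ cong (k *_) (length-++ (u x)) ⟩
    k * (length (u x) + length (concatMap u xs))      ≡⟨ *-distribˡ-+ k (length (u x)) _ ⟩
    k * length (u x) + k * length (concatMap u xs)    ≤⟨ +-mono-≤ (h (here refl)) (length-concatMap-≤ k c u xs (h ∘ there)) ⟩
    c + length xs * c                                 ∎
    where open ≤-Reasoning

  -- Indicator lists of the subsets of {0, ..., n - 1} with at most s elements.
  smallSets : ℕ → ℕ → List (List Bool)
  smallSets zero    s       = [] ∷ []
  smallSets (suc n) zero    = map (false ∷_) (smallSets n zero)
  smallSets (suc n) (suc s) = map (false ∷_) (smallSets n (suc s)) ++ map (true ∷_) (smallSets n s)

  ∈-smallSets : ∀ n s p → Σ< n (𝟙 ∘ p) ≤ s → applyUpTo p n ∈ smallSets n s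
  ∈-smallSets zero    s       p h = here refl
  ∈-smallSets (suc n) zero    p h with p 0
  ... | false = ∈-map⁺ (false ∷_) (∈-smallSets n zero (p ∘ suc) h)
  ∈-smallSets (suc n) (suc s) p h with p 0 | h
  ... | false | h       = ∈-++⁺ˡ (∈-map⁺ (false ∷_) (∈-smallSets n (suc s) (p ∘ suc) h))
  ... | true  | (s≤s h) = ∈-++⁺ʳ _ (∈-map⁺ (true ∷_) (∈-smallSets n s (p ∘ suc) h))

  smallSets-small : ∀ n s {E} → E ∈ smallSets n s → Σ< n (𝟙 ∘ at false E) ≤ s
  smallSets-small zero    s       _  = z≤n
  smallSets-small (suc n) zero    E∈ with ∈-map⁻ (false ∷_) E∈
  ... | E′ , E′∈ , refl = smallSets-small n zero E′∈
  smallSets-small (suc n) (suc s) E∈ with ∈-++⁻ (map (false ∷_) (smallSets n (suc s))) E∈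
  ... | inj₁ ∈₀ with ∈-map⁻ (false ∷_) ∈₀
  ...   | E′ , E′∈ , refl = smallSets-small n (suc s) E′∈
  smallSets-small (suc n) (suc s) E∈ | inj₂ ∈₁ with ∈-map⁻ (true ∷_) ∈₁
  ...   | E′ , E′∈ , refl = s≤s (smallSets-small n s E′∈)

  -- Give a subset with `j` elements the weight `b ^ s / b ^ j`, which is at least 1 when `j ≤ s`;
  -- over all subsets the weights add up to `b ^ s * (1 + 1/b) ^ n`. The parameter `b` stays free
  -- until `subexponential` chooses it.
  length-smallSets : ∀ n s b .{{_ : NonZero b}} → b ^ n * length (smallSets n s) ≤ b ^ s * suc b ^ n
  length-smallSets zero    s       b = *-monoˡ-≤ 1 (m^n>0 b s)
  length-smallSets (suc n) zero    b = begin
    b * b ^ n * length (map (false ∷_) (smallSets n 0))    ≡⟨ cong (b * b ^ n *_) (length-map (false ∷_) (smallSets n 0)) ⟩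
    b * b ^ n * length (smallSets n 0)                     ≡⟨ *-assoc b (b ^ n) _ ⟩
    b * (b ^ n * length (smallSets n 0))                   ≤⟨ *-mono-≤ (n≤1+n b) (length-smallSets n 0 b) ⟩
    suc b * (1 * suc b ^ n)                                ≡⟨ regroup (suc b) (suc b ^ n) ⟩
    1 * (suc b * suc b ^ n)                                ∎
    where
    open ≤-Reasoning
    regroup : ∀ x y → x * (1 * y) ≡ 1 * (x * y)
    regroup = solve-∀
  length-smallSets (suc n) (suc s) b = begin
    b * b ^ n * length (smallSets (suc n) (suc s))                    ≡⟨ cong (b * b ^ n *_) pascal ⟩
    b * b ^ n * (S₁ + S₀)                                             ≡⟨ distribute b (b ^ n) S₁ S₀ ⟩
    b * (b ^ n * S₁) + b * (b ^ n * S₀)                               ≤⟨ +-mono-≤ (*-monoʳ-≤ b (length-smallSets n (suc s) b)) (*-monoʳ-≤ b (length-smallSets n s b)) ⟩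
    b * (b * b ^ s * suc b ^ n) + b * (b ^ s * suc b ^ n)             ≡⟨ collect b (b ^ s) (suc b ^ n) ⟩
    b * b ^ s * (suc b * suc b ^ n)                                   ∎
    where
    open ≤-Reasoning
    S₁ = length (smallSets n (suc s))
    S₀ = length (smallSets n s)
    pascal : length (smallSets (suc n) (suc s)) ≡ S₁ + S₀
    pascal = trans (length-++ (map (false ∷_) (smallSets n (suc s))))
      (cong₂ _+_ (length-map (false ∷_) (smallSets n (suc s))) (length-map (true ∷_) (smallSets n s)))
    distribute : ∀ b x y z → b * x * (y + z) ≡ b * (x * y) + b * (x * z)
    distribute = solve-∀
    collect : ∀ b x y → b * (b * x * y) + b * (x * y) ≡ b * x * (suc b * y)
    collect = solve-∀

  choices : (ℕ → List A) → ℕ → List (List A)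
  choices o zero    = [] ∷ []
  choices o (suc n) = cartesianProductWith _∷_ (o 0) (choices (o ∘ suc) n)

  ∈-choices : ∀ n (o : ℕ → List A) y → (∀ i → i < n → y i ∈ o i) → applyUpTo y n ∈ choices o n
  ∈-choices zero    o y h = here refl
  ∈-choices (suc n) o y h = ∈-cartesianProductWith⁺ _∷_ (h 0 z<s) (∈-choices n (o ∘ suc) (y ∘ suc) (λ i i<n → h (suc i) (s<s i<n)))

  length-choices : ∀ n (o : ℕ → List A) → length (choices o n) ≡ Π< n (length ∘ o)
  length-choices zero    o = refl
  length-choices (suc n) o = trans (length-product (o 0)) (cong (length (o 0) *_) (length-choices n (o ∘ suc)))
    where
    ys = choices (o ∘ suc) n
    length-product : ∀ xs → length (cartesianProductWith _∷_ xs ys) ≡ length xs * length ys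
    length-product []       = refl
    length-product (x ∷ xs) = trans (length-++ (map (x ∷_) ys)) (cong₂ _+_ (length-map (x ∷_) ys) (length-product xs))

  ≤⇒≤ᵇ≡true : ∀ {m n} → m ≤ n → (m ≤ᵇ n) ≡ true
  ≤⇒≤ᵇ≡true m≤n = Equivalence.to T-≡ (≤⇒≤ᵇ m≤n)

  ≤ᵇ≡true⇒≤ : ∀ m n → (m ≤ᵇ n) ≡ true → m ≤ n
  ≤ᵇ≡true⇒≤ m n eq = ≤ᵇ⇒≤ m n (Equivalence.from T-≡ eq)

  >⇒≤ᵇ≡false : ∀ {m n} → n < m → (m ≤ᵇ n) ≡ false
  >⇒≤ᵇ≡false {m} {n} n<m with m ≤ᵇ n in eq
  ... | true  = contradiction (≤ᵇ≡true⇒≤ m n eq) (<⇒≱ n<m)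
  ... | false = refl

  ∧≡true : ∀ {x y} → x ∧ y ≡ true → x ≡ true × y ≡ true
  ∧≡true {true} eq = refl , eq

  𝟙≤1 : ∀ b → 𝟙 b ≤ 1
  𝟙≤1 true  = ≤-refl
  𝟙≤1 false = z≤n

  -- The set `covered` below is defined with the help of `Λ`. This description needs only `D` and
  -- the chosen elements, so `W` can be rebuilt from a code.
  shadow : (D X : ℕ → Bool) → ℕ → ℕ → Bool
  shadow D X zero    w = false
  shadow D X (suc k) w = shadow D X k w ∨ (X k ∧ D (w + k))

  shadow-cong : ∀ D {X Y} k w → (∀ n → n < k → X n ≡ Y n) → shadow D X k w ≡ shadow D Y k w
  shadow-cong D zero    w h = refl
  shadow-cong D (suc k) w h = cong₂ (λ a b → a ∨ (b ∧ D (w + k))) (shadow-cong D k w (λ n n<k → h n (m<n⇒m<1+n n<k))) (h k (n<1+n k))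

  module Fingerprint (N τ : ℕ) (D Λ : ℕ → Bool) where

    fresh : (ℕ → Bool) → ℕ → ℕ
    fresh W n = Σ< N (λ w → 𝟙 (D (w + n) ∧ not (W w)))

    covered : ℕ → ℕ → Bool
    chosen  : ℕ → Bool
    covered zero    w = false
    covered (suc k) w = covered k w ∨ (chosen k ∧ D (w + k))
    chosen k = Λ k ∧ (τ ≤ᵇ fresh (covered k) k)

    covered≡shadow : ∀ k w → covered k w ≡ shadow D chosen k w
    covered≡shadow zero    w = refl
    covered≡shadow (suc k) w = cong (_∨ (chosen k ∧ D (w + k))) (covered≡shadow k w)

    covered-sound : ∀ k w → covered k w ≡ true → ∃ λ x → Λ x ≡ true × D (w + x) ≡ true
    covered-sound (suc k) w eq with covered k w in eq′
    ... | true  = covered-sound k w eq′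
    ... | false with ∧≡true {chosen k} eq
    ...   | k-chosen , w+k∈D = k , proj₁ (∧≡true {Λ k} k-chosen) , w+k∈D

    -- Each chosen element covers at least `τ` numbers below `N` that were not covered before.
    chosen-few : ∀ k → τ * Σ< k (𝟙 ∘ chosen) ≤ Σ< N (𝟙 ∘ covered k)
    chosen-few zero    = ≤-trans (≤-reflexive (*-zeroʳ τ)) z≤n
    chosen-few (suc k) = begin
      τ * Σ< (suc k) (𝟙 ∘ chosen)                        ≡⟨ cong (τ *_) (Σ<-snoc k (𝟙 ∘ chosen)) ⟩
      τ * (Σ< k (𝟙 ∘ chosen) + 𝟙 (chosen k))             ≡⟨ *-distribˡ-+ τ (Σ< k (𝟙 ∘ chosen)) (𝟙 (chosen k)) ⟩
      τ * Σ< k (𝟙 ∘ chosen) + τ * 𝟙 (chosen k)           ≤⟨ +-mono-≤ (chosen-few k) gain ⟩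
      Σ< N (𝟙 ∘ covered k) + Σ< N added                  ≡⟨ Σ<-+ N (𝟙 ∘ covered k) added ⟨
      Σ< N (λ w → 𝟙 (covered k w) + added w)             ≡⟨ Σ<-cong N (λ w _ → sym (𝟙-∨ (covered k w) (chosen k ∧ D (w + k)))) ⟩
      Σ< N (𝟙 ∘ covered (suc k))                         ∎
      where
      open ≤-Reasoning
      added : ℕ → ℕ
      added w = 𝟙 ((chosen k ∧ D (w + k)) ∧ not (covered k w))
      𝟙-∨ : ∀ a b → 𝟙 (a ∨ b) ≡ 𝟙 a + 𝟙 (b ∧ not a)
      𝟙-∨ true  true  = refl
      𝟙-∨ true  false = refl
      𝟙-∨ false true  = refl
      𝟙-∨ false false = refl
      gain : τ * 𝟙 (chosen k) ≤ Σ< N added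
      gain with chosen k in eq
      ... | true  = ≤-trans (≤-reflexive (*-identityʳ τ)) (≤ᵇ≡true⇒≤ τ _ (proj₂ (∧≡true {Λ k} eq)))
      ... | false = ≤-trans (≤-reflexive (*-zeroʳ τ)) z≤n

    fresh-antitone : ∀ k n → fresh (covered (suc k)) n ≤ fresh (covered k) n
    fresh-antitone k n = Σ<-mono N (λ w _ → pointwise (D (w + n)) (covered k w) _)
      where
      pointwise : ∀ a b c → 𝟙 (a ∧ not (b ∨ c)) ≤ 𝟙 (a ∧ not b)
      pointwise false b     c     = z≤n
      pointwise true  true  c     = z≤n
      pointwise true  false true  = z≤n
      pointwise true  false false = ≤-refl

    -- Right after `n` is examined nothing is fresh for it if it was chosen, and fewer than `τ`
    -- numbers are if it was rejected; later steps only lower the count.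
    fresh-few : ∀ k n → n < k → Λ n ≡ true → fresh (covered k) n ≤ τ
    fresh-few (suc k) n (s<s n≤k) n∈Λ with m≤n⇒m<n∨m≡n n≤k
    ... | inj₁ n<k  = ≤-trans (fresh-antitone k n) (fresh-few k n n<k n∈Λ)
    ... | inj₂ refl = last (τ ≤ᵇ fresh (covered n) n) refl
      where
      vanish : ∀ a b c → c ≡ true → 𝟙 (a ∧ not (b ∨ (c ∧ a))) ≡ 0
      vanish true  true  true refl = refl
      vanish true  false true refl = refl
      vanish false b     c    _    = refl
      last : ∀ b → (τ ≤ᵇ fresh (covered n) n) ≡ b → fresh (covered (suc n)) n ≤ τ
      last true  eq = ≤-trans (≤-reflexive (trans
        (Σ<-cong N (λ w _ → vanish (D (w + n)) (covered n w) (chosen n) (cong₂ _∧_ n∈Λ eq)))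
        (trans (Σ<-const N 0) (*-zeroʳ N)))) z≤n
      last false eq = ≤-trans (fresh-antitone n n) (≰⇒≥ λ τ≤ → contradiction (trans (sym (≤⇒≤ᵇ≡true τ≤)) eq) λ ())

    exceptional : ℕ → ℕ → Bool
    exceptional g n = Λ n ∧ ((n ≤ᵇ g) ∧ not (covered N (g ∸ n)))

    -- Double counting. For a fixed `n` in `Λ`, the substitution `w = g ∸ n` turns the gaps `g` for
    -- which `n` is exceptional into numbers still fresh for `n` at the end, and `fresh-few` bounds
    -- these.
    exceptions-few : Σ< N (λ g → 𝟙 (D g) * Σ< N (𝟙 ∘ exceptional g)) ≤ N * τ
    exceptions-few = begin
      Σ< N (λ g → 𝟙 (D g) * Σ< N (𝟙 ∘ exceptional g))          ≡⟨ Σ<-cong N (λ g _ → sym (Σ<-*ˡ N (𝟙 (D g)) (𝟙 ∘ exceptional g))) ⟩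
      Σ< N (λ g → Σ< N (λ n → 𝟙 (D g) * 𝟙 (exceptional g n)))  ≡⟨ Σ<-swap N N (λ g n → 𝟙 (D g) * 𝟙 (exceptional g n)) ⟩
      Σ< N (λ n → Σ< N (λ g → 𝟙 (D g) * 𝟙 (exceptional g n)))  ≤⟨ Σ<-mono N per-element ⟩
      Σ< N (λ _ → τ)                                           ≡⟨ Σ<-const N τ ⟩
      N * τ                                                    ∎
      where
      open ≤-Reasoning
      per-element : ∀ n → n < N → Σ< N (λ g → 𝟙 (D g) * 𝟙 (exceptional g n)) ≤ τ
      per-element n n<N with Λ n in n∈Λ
      ... | false = ≤-trans (≤-reflexive (trans (Σ<-cong N (λ g _ → *-zeroʳ (𝟙 (D g)))) (trans (Σ<-const N 0) (*-zeroʳ N)))) z≤n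
      ... | true  = begin
        Σ< N (λ g → u g (g ∸ n))            ≤⟨ Σ<-shift n N u below ⟩
        Σ< N (λ w → u (w + n) w)            ≤⟨ Σ<-mono N (λ w _ → absorb (D (w + n)) (n ≤ᵇ w + n) (not (covered N w))) ⟩
        fresh (covered N) n                 ≤⟨ fresh-few N n n<N n∈Λ ⟩
        τ                                   ∎
        where
        u : ℕ → ℕ → ℕ
        u g w = 𝟙 (D g) * 𝟙 ((n ≤ᵇ g) ∧ not (covered N w))
        below : ∀ {g} → g < n → ∀ w → u g w ≡ 0
        below {g} g<n w rewrite >⇒≤ᵇ≡false g<n = *-zeroʳ (𝟙 (D g))
        absorb : ∀ a b c → 𝟙 a * 𝟙 (b ∧ c) ≤ 𝟙 (a ∧ c)
        absorb false b     c = z≤n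
        absorb true  false c = z≤n
        absorb true  true  c = ≤-reflexive (+-identityʳ (𝟙 c))

  abstract
    below-average : ∀ N (D : ℕ → Bool) (h : ℕ → ℕ) S → 0 < Σ< N (𝟙 ∘ D) → Σ< N (λ g → 𝟙 (D g) * h g) ≤ S →
                    ∃ λ g → g < N × D g ≡ true × Σ< N (𝟙 ∘ D) * h g ≤ S
    below-average N D h S d>0 sum≤ with anyUpTo? (λ g → (D g ≟ᵇ true) ×-dec (Σ< N (𝟙 ∘ D) * h g ≤? S)) N
    ... | yes found = found
    ... | no  none  = contradiction absurd (<-irrefl refl)
      where
      open ≤-Reasoning
      d : ℕ
      d = Σ< N (𝟙 ∘ D)
      weight : ∀ g → g < N → suc S * 𝟙 (D g) ≤ d * (𝟙 (D g) * h g)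
      weight g g<N with D g in eq
      ... | false = ≤-trans (≤-reflexive (*-zeroʳ S)) z≤n
      ... | true  = begin
        suc S * 1          ≡⟨ *-identityʳ (suc S) ⟩
        suc S              ≤⟨ ≰⇒> (λ dh≤S → none (g , g<N , eq , dh≤S)) ⟩
        d * h g            ≡⟨ cong (d *_) (+-identityʳ (h g)) ⟨
        d * (h g + 0)      ∎
      absurd : d * S < d * S
      absurd = begin-strict
        d * S                                       <⟨ *-monoʳ-< d {{>-nonZero d>0}} (n<1+n S) ⟩
        d * suc S                                   ≡⟨ *-comm d (suc S) ⟩
        suc S * d                                   ≡⟨ Σ<-*ˡ N (suc S) (𝟙 ∘ D) ⟨
        Σ< N (λ g → suc S * 𝟙 (D g))                ≤⟨ Σ<-mono N weight ⟩
        Σ< N (λ g → d * (𝟙 (D g) * h g))            ≡⟨ Σ<-*ˡ N d (λ g → 𝟙 (D g) * h g) ⟩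
        d * Σ< N (λ g → 𝟙 (D g) * h g)              ≤⟨ *-monoʳ-≤ d sum≤ ⟩
        d * S                                       ∎

    top-elements : ∀ N (G : ℕ → Bool) d → d ≤ Σ< N (𝟙 ∘ G) → ∃ λ h → h ≤ N × Σ< N (λ n → 𝟙 ((h ≤ᵇ n) ∧ G n)) ≡ d
    top-elements N       G zero    _  = N , ≤-refl , trans (Σ<-cong N (λ n n<N → cong (λ b → 𝟙 (b ∧ G n)) (>⇒≤ᵇ≡false n<N))) (trans (Σ<-const N 0) (*-zeroʳ N))
    top-elements (suc N) G (suc d) d≤ = go (G N) refl (≤-trans d≤ (≤-reflexive (Σ<-snoc N (𝟙 ∘ G))))
      where
      go : ∀ b → G N ≡ b → suc d ≤ Σ< N (𝟙 ∘ G) + 𝟙 b → ∃ λ h → h ≤ suc N × Σ< (suc N) (λ n → 𝟙 ((h ≤ᵇ n) ∧ G n)) ≡ suc d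
      go true  eq d≤ with top-elements N G d (s≤s⁻¹ (≤-trans d≤ (≤-reflexive (+-comm _ 1))))
      ... | h , h≤N , sum = h , m≤n⇒m≤1+n h≤N ,
        trans (Σ<-snoc N _) (trans (cong₂ _+_ sum (cong₂ (λ a b → 𝟙 (a ∧ b)) (≤⇒≤ᵇ≡true h≤N) eq)) (+-comm d 1))
      go false eq d≤ with top-elements N G (suc d) (≤-trans d≤ (≤-reflexive (+-identityʳ _)))
      ... | h , h≤N , sum = h , m≤n⇒m≤1+n h≤N ,
        trans (Σ<-snoc N _) (trans (cong₂ _+_ sum (cong₂ (λ a b → 𝟙 (a ∧ b)) (≤⇒≤ᵇ≡true h≤N) eq)) (+-identityʳ (suc d)))

  -- Counting in the classes modulo m

  -- Separates the exceptions from the regular candidates: each exception at most doubles the number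
  -- of options of its class.
  suc[x+y]≤suc[x]*2^y : ∀ x y → suc (x + y) ≤ suc x * 2 ^ y
  suc[x+y]≤suc[x]*2^y x zero    = ≤-reflexive (trans (cong suc (+-identityʳ x)) (sym (*-identityʳ (suc x))))
  suc[x+y]≤suc[x]*2^y x (suc y) = begin
    suc (x + suc y)                    ≡⟨ cong suc (+-suc x y) ⟩
    1 + suc (x + y)                    ≤⟨ +-monoˡ-≤ (suc (x + y)) (s≤s z≤n) ⟩
    suc (x + y) + suc (x + y)          ≤⟨ +-mono-≤ (suc[x+y]≤suc[x]*2^y x y) (suc[x+y]≤suc[x]*2^y x y) ⟩
    suc x * 2 ^ y + suc x * 2 ^ y      ≡⟨ double (suc x) (2 ^ y) ⟩
    suc x * (2 * 2 ^ y)                ∎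
    where
    open ≤-Reasoning
    double : ∀ a b → a * b + a * b ≡ a * (2 * b)
    double = solve-∀

  -- An option for the class of i is the quotient by m of its smallest element, or K if that element exceeds g.
  module Classes (m g K : ℕ) (W E : ℕ → Bool) where

    candidate : ℕ → Bool
    candidate n = (n ≤ᵇ g) ∧ (not (W n) ∧ (W (g ∸ n) ∨ E n))

    options : ℕ → List ℕ
    options i = K ∷ filterᵇ (λ a → candidate (i + a * m)) (upTo K)

    regular : ℕ → Bool
    regular n = (n ≤ᵇ g) ∧ (not (W n) ∧ W (g ∸ n))

    regulars exceptions : ℕ → ℕ
    regulars   i = Σ< K (λ a → 𝟙 (regular (i + a * m)))
    exceptions i = Σ< K (λ a → 𝟙 ((i + a * m ≤ᵇ g) ∧ E (i + a * m)))

    length-options : ∀ i → length (options i) ≤ suc (regulars i) * 2 ^ exceptions i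
    length-options i = begin
      length (options i)                                ≡⟨ cong suc (length-filterᵇ-applyUpTo (λ a → candidate (i + a * m)) id K) ⟩
      suc (Σ< K (λ a → 𝟙 (candidate (i + a * m))))      ≤⟨ s≤s (Σ<-mono K (λ a _ → pointwise (i + a * m ≤ᵇ g) (not (W (i + a * m))) _ (E (i + a * m)))) ⟩
      suc (Σ< K (λ a → 𝟙 (regular (i + a * m)) + 𝟙 ((i + a * m ≤ᵇ g) ∧ E (i + a * m))))
                                                        ≡⟨ cong suc (Σ<-+ K _ _) ⟩
      suc (regulars i + exceptions i)                   ≤⟨ suc[x+y]≤suc[x]*2^y (regulars i) (exceptions i) ⟩
      suc (regulars i) * 2 ^ exceptions i               ∎
      where
      open ≤-Reasoning
      pointwise : ∀ a b c d → 𝟙 (a ∧ (b ∧ (c ∨ d))) ≤ 𝟙 (a ∧ (b ∧ c)) + 𝟙 (a ∧ d)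
      pointwise false b     c     d     = z≤n
      pointwise true  false c     d     = z≤n
      pointwise true  true  true  d     = s≤s z≤n
      pointwise true  true  false d     = ≤-refl

    Σ-exceptions : ∀ {N} → g < N → Σ< m exceptions ≤ Σ< N (𝟙 ∘ E)
    Σ-exceptions {N} g<N = begin
      Σ< m exceptions                          ≡⟨ Σ<-residues m K (λ n → 𝟙 ((n ≤ᵇ g) ∧ E n)) ⟩
      Σ< (K * m) (λ n → 𝟙 ((n ≤ᵇ g) ∧ E n))    ≤⟨ Σ<-support (K * m) N _ (λ n N≤n → cong (λ b → 𝟙 (b ∧ E n)) (>⇒≤ᵇ≡false (<-≤-trans g<N N≤n))) ⟩
      Σ< N (λ n → 𝟙 ((n ≤ᵇ g) ∧ E n))          ≤⟨ Σ<-mono N (λ n _ → drop (n ≤ᵇ g) (E n)) ⟩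
      Σ< N (𝟙 ∘ E)                             ∎
      where
      open ≤-Reasoning
      drop : ∀ a b → 𝟙 (a ∧ b) ≤ 𝟙 b
      drop true  b = ≤-refl
      drop false b = z≤n

    -- `regular n` demands that `n′ = g ∸ n` lie in `W`, which `regular n′` forbids.
    regular-exclusive : ∀ n n′ → n + n′ ≡ g → 𝟙 (regular n) + 𝟙 (regular n′) ≤ 1
    regular-exclusive n n′ n+n′≡g = ≤-trans
      (≤-reflexive (cong₂ (λ x y → 𝟙 ((n ≤ᵇ g) ∧ (not (W n) ∧ W x)) + 𝟙 ((n′ ≤ᵇ g) ∧ (not (W n′) ∧ W y))) g∸n g∸n′))
      (exclusive (n ≤ᵇ g) (n′ ≤ᵇ g) (W n) (W n′))
      where
      g∸n : g ∸ n ≡ n′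
      g∸n = trans (cong (_∸ n) (sym n+n′≡g)) (m+n∸m≡n n n′)
      g∸n′ : g ∸ n′ ≡ n
      g∸n′ = trans (cong (_∸ n′) (sym n+n′≡g)) (m+n∸n≡m n n′)
      exclusive : ∀ a b c d → 𝟙 (a ∧ (not c ∧ d)) + 𝟙 (b ∧ (not d ∧ c)) ≤ 1
      exclusive false b c     d = 𝟙≤1 (b ∧ (not d ∧ c))
      exclusive true  b true  d = 𝟙≤1 (b ∧ (not d ∧ true))
      exclusive true  false false d = ≤-trans (≤-reflexive (+-identityʳ _)) (𝟙≤1 d)
      exclusive true  true  false true  = ≤-refl
      exclusive true  true  false false = z≤n

    -- Reflection in `g` takes position `a` of one class to position `k - 1 - a` of the other, and
    -- at most one number of each such pair is regular. From position `k` on, both classes lie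
    -- beyond `g`.
    opposite-classes : ∀ i j k → (∀ a → k ≤ a → g < i + a * m) → (∀ a → k ≤ a → g < j + a * m) →
                       (∀ a b → suc (a + b) ≡ k → (i + a * m) + (j + b * m) ≡ g) →
                       suc (regulars i) * suc (regulars j) ≤ T k
    opposite-classes i j k beyondᵢ beyondⱼ opposite = suc*suc≤T (regulars i) (regulars j) k (begin
      regulars i + regulars j                                                                ≤⟨ +-mono-≤ (truncate i beyondᵢ) (truncate j beyondⱼ) ⟩
      Σ< k (λ a → 𝟙 (regular (i + a * m))) + Σ< k (λ a → 𝟙 (regular (j + a * m)))            ≤⟨ Σ<-mirror k 1 _ _ (λ a b e → regular-exclusive (i + a * m) (j + b * m) (opposite a b e)) ⟩
      k * 1                                                                                  ≡⟨ *-identityʳ k ⟩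
      k                                                                                      ∎)
      where
      open ≤-Reasoning
      truncate : ∀ i → (∀ a → k ≤ a → g < i + a * m) → regulars i ≤ Σ< k (λ a → 𝟙 (regular (i + a * m)))
      truncate i beyond = Σ<-support K k _ (λ a k≤a → cong (λ b → 𝟙 (b ∧ (not (W (i + a * m)) ∧ W (g ∸ (i + a * m))))) (>⇒≤ᵇ≡false (beyond a k≤a)))

    -- The classes `0` to `R` meet `[0, g]` in `Q + 1` elements and are paired by `i + j = R`; the
    -- other `m′` classes meet it in `Q` elements and are paired by `i + j = R + m`.
    Π-regulars : ∀ Q R m′ → m ≡ suc R + m′ → g ≡ R + Q * m →
                 Π< m (suc ∘ regulars) * Π< m (suc ∘ regulars) ≤ T (suc Q) ^ suc R * T Q ^ m′
    Π-regulars Q R m′ m≡ g≡ = begin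
      Π< m h * Π< m h                                                      ≡⟨ cong (λ x → x * x) (trans (cong (λ x → Π< x h) m≡) (Π<-split (suc R) m′ h)) ⟩
      (Π< (suc R) h * Π< m′ h′) * (Π< (suc R) h * Π< m′ h′)                ≡⟨ [m*n]*[o*p]≡[m*o]*[n*p] (Π< (suc R) h) _ _ _ ⟩
      (Π< (suc R) h * Π< (suc R) h) * (Π< m′ h′ * Π< m′ h′)                ≤⟨ *-mono-≤ (Π<-mirror (suc R) _ h h low) (Π<-mirror m′ _ h′ h′ high) ⟩
      T (suc Q) ^ suc R * T Q ^ m′                                         ∎
      where
      open ≤-Reasoning
      h h′ : ℕ → ℕ
      h = suc ∘ regulars
      h′ i = h (suc R + i)
      low : ∀ i j → suc (i + j) ≡ suc R → h i * h j ≤ T (suc Q)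
      low i j i+j≡R = opposite-classes i j (suc Q) (beyond i) (beyond j) (λ a b e → trans (regroup i j a b m) (trans (cong₂ (λ x y → x + y * m) (suc-injective i+j≡R) (suc-injective e)) (sym g≡)))
        where
        regroup : ∀ i j a b m → i + a * m + (j + b * m) ≡ i + j + (a + b) * m
        regroup = solve-∀
        beyond : ∀ i a → suc Q ≤ a → g < i + a * m
        beyond i a Q<a = begin-strict
          g                ≡⟨ g≡ ⟩
          R + Q * m        <⟨ +-monoˡ-< (Q * m) (≤-trans (m≤m+n (suc R) m′) (≤-reflexive (sym m≡))) ⟩
          suc Q * m        ≤⟨ *-monoˡ-≤ m Q<a ⟩
          a * m            ≤⟨ m≤n+m (a * m) i ⟩
          i + a * m        ∎
      high : ∀ i j → suc (i + j) ≡ m′ → h′ i * h′ j ≤ T Q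
      high i j i+j≡m′ = opposite-classes (suc R + i) (suc R + j) Q (beyond i) (beyond j) (λ a b e → begin-equality
          suc R + i + a * m + (suc R + j + b * m)      ≡⟨ regroup R i j a b m ⟩
          R + (suc R + suc (i + j)) + (a + b) * m      ≡⟨ cong (λ x → R + (suc R + x) + (a + b) * m) i+j≡m′ ⟩
          R + (suc R + m′) + (a + b) * m               ≡⟨ cong (λ x → R + x + (a + b) * m) m≡ ⟨
          R + m + (a + b) * m                          ≡⟨ +-assoc R m _ ⟩
          R + suc (a + b) * m                          ≡⟨ cong (λ x → R + x * m) e ⟩
          R + Q * m                                    ≡⟨ g≡ ⟨
          g                                            ∎)
        where
        regroup : ∀ R i j a b m → suc R + i + a * m + (suc R + j + b * m) ≡ R + (suc R + suc (i + j)) + (a + b) * m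
        regroup = solve-∀
        beyond : ∀ i a → Q ≤ a → g < suc R + i + a * m
        beyond i a Q≤a = begin-strict
          g                    ≡⟨ g≡ ⟩
          R + Q * m            <⟨ +-mono-≤ (m≤m+n (suc R) i) (*-monoˡ-≤ m Q≤a) ⟩
          suc R + i + a * m    ∎

  -- The gap `g` found by averaging may lie anywhere up to `f`, while the final bound speaks of `f`.
  -- Passing from `g` to `f`, no class loses elements, and `T` is monotone.
  T-weight-mono : ∀ {m p r Q R} → r < m → R < m → R + Q * m ≤ r + p * m →
                  T (suc Q) ^ suc R * T Q ^ (m ∸ suc R) ≤ T (suc p) ^ suc r * T p ^ (m ∸ suc r)
  T-weight-mono {m} {p} {r} {Q} {R} r<m R<m g≤f with <-cmp Q p
  ... | tri< Q<p _ _ = begin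
    T (suc Q) ^ suc R * T Q ^ (m ∸ suc R)    ≤⟨ *-mono-≤ (^-monoˡ-≤ (suc R) (T-mono Q<p)) (^-monoˡ-≤ (m ∸ suc R) (T-mono (<⇒≤ Q<p))) ⟩
    T p ^ suc R * T p ^ (m ∸ suc R)          ≡⟨ ^-distribˡ-+-* (T p) (suc R) _ ⟨
    T p ^ (suc R + (m ∸ suc R))              ≡⟨ cong (T p ^_) (trans (m+[n∸m]≡n R<m) (sym (m+[n∸m]≡n r<m))) ⟩
    T p ^ (suc r + (m ∸ suc r))              ≡⟨ ^-distribˡ-+-* (T p) (suc r) _ ⟩
    T p ^ suc r * T p ^ (m ∸ suc r)          ≤⟨ *-monoˡ-≤ _ (^-monoˡ-≤ (suc r) (T-mono (n≤1+n p))) ⟩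
    T (suc p) ^ suc r * T p ^ (m ∸ suc r)    ∎
    where open ≤-Reasoning
  ... | tri≈ _ refl _ = begin
    T (suc p) ^ suc R * T p ^ (m ∸ suc R)                      ≡⟨ cong (λ x → T (suc p) ^ suc R * T p ^ x) split ⟩
    T (suc p) ^ suc R * T p ^ (t + (m ∸ suc r))                ≡⟨ cong (T (suc p) ^ suc R *_) (^-distribˡ-+-* (T p) t _) ⟩
    T (suc p) ^ suc R * (T p ^ t * T p ^ (m ∸ suc r))          ≡⟨ *-assoc (T (suc p) ^ suc R) _ _ ⟨
    T (suc p) ^ suc R * T p ^ t * T p ^ (m ∸ suc r)            ≤⟨ *-monoˡ-≤ _ (*-monoʳ-≤ (T (suc p) ^ suc R) (^-monoˡ-≤ t (T-mono (n≤1+n p)))) ⟩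
    T (suc p) ^ suc R * T (suc p) ^ t * T p ^ (m ∸ suc r)      ≡⟨ cong (_* T p ^ (m ∸ suc r)) (^-distribˡ-+-* (T (suc p)) (suc R) t) ⟨
    T (suc p) ^ (suc R + t) * T p ^ (m ∸ suc r)                ≡⟨ cong (λ x → T (suc p) ^ suc x * T p ^ (m ∸ suc r)) (m+[n∸m]≡n R≤r) ⟩
    T (suc p) ^ suc r * T p ^ (m ∸ suc r)                      ∎
    where
    open ≤-Reasoning
    R≤r : R ≤ r
    R≤r = +-cancelʳ-≤ (p * m) R r g≤f
    t = r ∸ R
    split : m ∸ suc R ≡ t + (m ∸ suc r)
    split = sym (trans (+-comm t (m ∸ suc r)) (trans (sym (+-∸-assoc (m ∸ suc r) R≤r)) (trans (cong (_∸ R) (m∸suc[r]+r)) (pred-∸ m R))))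
      where
      m∸suc[r]+r : m ∸ suc r + r ≡ pred m
      m∸suc[r]+r = cong pred (trans (sym (+-suc (m ∸ suc r) r)) (m∸n+n≡m r<m))
      pred-∸ : ∀ m n → pred m ∸ n ≡ m ∸ suc n
      pred-∸ m n = trans (cong (_∸ n) (sym (pred[m∸n]≡m∸[1+n] m 0))) (∸-+-assoc m 1 n)
  ... | tri> _ _ p<Q = contradiction g≤f (<⇒≱ (begin-strict
    r + p * m      <⟨ +-monoˡ-< (p * m) r<m ⟩
    suc p * m      ≤⟨ *-monoˡ-≤ m p<Q ⟩
    Q * m          ≤⟨ m≤n+m (Q * m) R ⟩
    R + Q * m      ∎))
    where open ≤-Reasoning

  Π-options : ∀ m g K W E → let open Classes m g K W E in .{{_ : NonZero m}} →
    ∀ {N p r e} → g < N → Σ< N (𝟙 ∘ E) ≤ e → r < m → g ≤ r + p * m →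
    Π< m (length ∘ options) * Π< m (length ∘ options) ≤ (2 ^ e * 2 ^ e) * (T (suc p) ^ suc r * T p ^ (m ∸ suc r))
  Π-options m g K W E {N} {p} {r} {e} g<N E≤e r<m g≤f = begin
    Π< m (length ∘ options) * Π< m (length ∘ options)      ≤⟨ *-mono-≤ factor factor ⟩
    (H * 2 ^ e) * (H * 2 ^ e)                              ≡⟨ regroup H (2 ^ e) ⟩
    (2 ^ e * 2 ^ e) * (H * H)                              ≤⟨ *-monoʳ-≤ (2 ^ e * 2 ^ e) (≤-trans
                                                                (Π-regulars (g / m) (g % m) (m ∸ suc (g % m)) (sym (m+[n∸m]≡n R<m)) (m≡m%n+[m/n]*n g m))
                                                                (T-weight-mono {p = p} {Q = g / m} r<m R<m (≤-trans (≤-reflexive (sym (m≡m%n+[m/n]*n g m))) g≤f))) ⟩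
    (2 ^ e * 2 ^ e) * (T (suc p) ^ suc r * T p ^ (m ∸ suc r))    ∎
    where
    open ≤-Reasoning
    open Classes m g K W E
    R<m = m%n<n g m
    H = Π< m (suc ∘ regulars)
    regroup : ∀ x y → x * y * (x * y) ≡ y * y * (x * x)
    regroup = solve-∀
    factor : Π< m (length ∘ options) ≤ H * 2 ^ e
    factor = begin
      Π< m (length ∘ options)                                 ≤⟨ Π<-mono m (λ i _ → length-options i) ⟩
      Π< m (λ i → suc (regulars i) * 2 ^ exceptions i)        ≡⟨ Π<-* m (suc ∘ regulars) (λ i → 2 ^ exceptions i) ⟩
      H * Π< m (λ i → 2 ^ exceptions i)                       ≡⟨ cong (H *_) (Π<-^ m 2 exceptions) ⟩
      H * 2 ^ Σ< m exceptions                                 ≤⟨ *-monoʳ-≤ H (^-monoʳ-≤ 2 (≤-trans (Σ-exceptions g<N) E≤e)) ⟩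
      H * 2 ^ e                                               ∎

  -- Codes of semigroups

  module SemigroupFacts (Λ : NumericalSemigroup) (f p : ℕ) (FD : HasFrobeniusAndDepth f (suc p) Λ) where

    private
      instance _ = multiplicity-nonZero Λ
      m = multiplicity Λ
      m∈Λ = proj₁ (proj₁ (multiplicity-isLeast Λ))

    conductor≡ : conductor Λ ≡ suc f
    conductor≡ = frobenius⇒conductor Λ (proj₁ FD)

    beyond-f : ∀ {n} → f < n → elements Λ n
    beyond-f {n} f<n = subst (elements Λ) (m+[n∸m]≡n f<n)
      (subst (ContainsFrom Λ) conductor≡ (proj₁ (conductor-isLeast Λ)) (n ∸ suc f))

    f∉Λ : ¬ elements Λ f
    f∉Λ f∈Λ = <-irrefl refl (≤-trans (≤-reflexive (sym conductor≡)) (proj₂ (conductor-isLeast Λ) f contains))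
      where
      contains : ContainsFrom Λ f
      contains zero    = subst (elements Λ) (sym (+-identityʳ f)) f∈Λ
      contains (suc k) = beyond-f (m<m+n f z<s)

    multiple∈Λ : ∀ k → elements Λ (k * m)
    multiple∈Λ zero    = 0∈elements Λ
    multiple∈Λ (suc k) = +-closed Λ m∈Λ (multiple∈Λ k)

    minimal-m : ∀ {n} → elements Λ n → n ≢ 0 → m ≤ n
    minimal-m n∈Λ n≢0 = proj₂ (multiplicity-isLeast Λ) _ (n∈Λ , n≢0)

    -- The conductor is `f + 1`, so the ceiling that defines the depth equals `⌊f / m⌋ + 1`.
    f/m≡p : f / m ≡ p
    f/m≡p = suc-injective (begin
      suc (f / m)                 ≡⟨ cong (λ x → suc (x / m)) (m+n∸n≡m f m) ⟨
      suc ((f + m ∸ m) / m)       ≡⟨ m/n≡1+[m∸n]/n (m≤n+m m f) ⟨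
      (f + m) / m                 ≡⟨ cong (λ x → (f + x) / m) (suc-pred m) ⟨
      (f + suc (pred m)) / m      ≡⟨ cong (_/ m) (+-suc f (pred m)) ⟩
      (suc f + pred m) / m        ≡⟨ cong (λ c → (c + pred m) / m) conductor≡ ⟨
      depth Λ                     ≡⟨ proj₂ FD ⟩
      suc p                       ∎)
      where open ≡-Reasoning

    f≡ : f ≡ f % m + p * m
    f≡ = trans (m≡m%n+[m/n]*n f m) (cong (λ x → f % m + x * m) f/m≡p)

    remainder>0 : 0 < f % m
    remainder>0 = n≢0⇒n>0 λ r≡0 → f∉Λ (subst (elements Λ) (sym (trans f≡ (cong (_+ p * m) r≡0))) (multiple∈Λ p))

  first : (ℕ → Bool) → ℕ → ℕ
  first P zero    = zero
  first P (suc k) = if P 0 then 0 else suc (first (P ∘ suc) k)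

  first-least : ∀ P k a → P a ≡ true → first P k ≤ a
  first-least P zero    a       _  = z≤n
  first-least P (suc k) a       Pa with P 0 in eq
  ... | true  = z≤n
  first-least P (suc k) zero    Pa | false = contradiction (trans (sym Pa) eq) λ ()
  first-least P (suc k) (suc a) Pa | false = s≤s (first-least (P ∘ suc) k a Pa)

  first-holds : ∀ P k → first P k ≡ k ⊎ first P k < k × P (first P k) ≡ true
  first-holds P zero    = inj₁ refl
  first-holds P (suc k) with P 0 in eq
  ... | true  = inj₂ (z<s , eq)
  ... | false with first-holds (P ∘ suc) k
  ...   | inj₁ none      = inj₁ (cong suc none)
  ...   | inj₂ (<k , Pk) = inj₂ (s<s <k , Pk)

  Code : Set
  Code = ℕ × List Bool × ℕ × List ℕ

  χ : NumericalSemigroup → ℕ → Bool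
  χ Λ n = does (elements? Λ n)

  -- D lists the gaps above g, and y the quotient by m of the smallest element of each class modulo m.
  HasCode : NumericalSemigroup → Code → Set
  HasCode Λ (m , D , g , y) = NonZero m ×
    (∀ i a → i < m → i + a * m ≤ g → χ Λ (i + a * m) ≡ (at 0 y i ≤ᵇ a)) ×
    (∀ n → g < n → χ Λ n ≡ not (at false D n))

  χ-true : ∀ Λ {n} → elements Λ n → χ Λ n ≡ true
  χ-true Λ {n} = dec-true (elements? Λ n)

  χ-element : ∀ Λ {n} → χ Λ n ≡ true → elements Λ n
  χ-element Λ {n} eq with elements? Λ n
  ... | yes n∈Λ = n∈Λ

  HasCode-injective : ∀ Λ Λ′ {c} → HasCode Λ c → HasCode Λ′ c → ∀ {n} → elements Λ n → elements Λ′ n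
  HasCode-injective Λ Λ′ {m , D , g , y} (m≢0 , low , high) (_ , low′ , high′) {n} n∈Λ with n ≤? g
  ... | no  n≰g = χ-element Λ′ (trans (high′ n (≰⇒> n≰g)) (trans (sym (high n (≰⇒> n≰g))) (χ-true Λ n∈Λ)))
  ... | yes n≤g = χ-element Λ′ (trans (cong (χ Λ′) n≡) (trans (low′ (n % m) (n / m) R<m n≤g′) (trans (sym (low (n % m) (n / m) R<m n≤g′)) (χ-true Λ (subst (elements Λ) n≡ n∈Λ)))))
    where
    instance _ = m≢0
    R<m = m%n<n n m
    n≡ = m≡m%n+[m/n]*n n m
    n≤g′ = ≤-trans (≤-reflexive (sym n≡)) n≤g

  optionsFor : ℕ → ℕ → List Bool → List Bool → List Bool → ℕ → ℕ → List ℕ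
  optionsFor N m D X E g = Classes.options m g N (shadow (at false D) (at false X) N) (at false E)

  codes : (N s : ℕ) (ms : List ℕ) → List Code
  codes N s ms =
    concatMap (λ m →
    concatMap (λ D →
    concatMap (λ X →
    concatMap (λ E →
    concatMap (λ g →
      map (λ y → m , D , g , y) (choices (optionsFor N m D X E g) m))
      (upTo N)) (smallSets N s)) (smallSets N s)) (smallSets N s)) ms

  ∈-codes : ∀ {N s ms m D X E g y} → m ∈ ms → D ∈ smallSets N s → X ∈ smallSets N s → E ∈ smallSets N s → g < N →
            y ∈ choices (optionsFor N m D X E g) m → (m , D , g , y) ∈ codes N s ms
  ∈-codes {m = m} {D} {X} {E} {g} m∈ D∈ X∈ E∈ g<N y∈ =
    ∈-concatMap⁺ _ (lose m∈ (∈-concatMap⁺ _ (lose D∈ (∈-concatMap⁺ _ (lose X∈ (∈-concatMap⁺ _ (lose E∈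
      (∈-concatMap⁺ _ (lose (∈-upTo⁺ g<N) (∈-map⁺ _ y∈))))))))))

  m*n≤o⇒n≤o/m : ∀ m n o .{{_ : NonZero m}} → m * n ≤ o → n ≤ o / m
  m*n≤o⇒n≤o/m m n o mn≤o = ≤-trans (≤-reflexive (trans (sym (m*n/n≡m n m)) (cong (_/ m) (*-comm n m)))) (/-monoˡ-≤ m mn≤o)

  module ClassCode (Λ : NumericalSemigroup) (N m g : ℕ) {{m≢0 : NonZero m}} (g<N : g < N) (W E : ℕ → Bool)
                   (multiple∈Λ : ∀ k → elements Λ (k * m)) (W-gap : ∀ n → W n ≡ true → χ Λ n ≡ false)
                   (E-exception : ∀ n → n ≤ g → χ Λ n ≡ true → W (g ∸ n) ≡ false → E n ≡ true) where

    open Classes m g N W E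

    element⇒candidate : ∀ {n} → n ≤ g → χ Λ n ≡ true → candidate n ≡ true
    element⇒candidate {n} n≤g n∈Λ = cong₂ _∧_ (≤⇒≤ᵇ≡true n≤g) (cong₂ (λ a b → not a ∧ b) n∉W W∨E)
      where
      n∉W : W n ≡ false
      n∉W with W n in eq
      ... | false = refl
      ... | true  = contradiction (trans (sym n∈Λ) (W-gap n eq)) λ ()
      W∨E : W (g ∸ n) ∨ E n ≡ true
      W∨E with W (g ∸ n) in eq
      ... | true  = refl
      ... | false = E-exception n n≤g n∈Λ eq

    present : ℕ → ℕ → Bool
    present i a = (i + a * m ≤ᵇ g) ∧ χ Λ (i + a * m)

    y : ℕ → ℕ
    y i = first (present i) N

    y∈options : ∀ i → y i ∈ options i
    y∈options i with first-holds (present i) N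
    ... | inj₁ none = here none
    ... | inj₂ (y<N , holds) = there (∈-filter⁺ (T? ∘ λ a → candidate (i + a * m)) (∈-upTo⁺ y<N)
      (Equivalence.from T-≡ (element⇒candidate (≤ᵇ≡true⇒≤ _ g (proj₁ both)) (proj₂ both))))
      where both = ∧≡true {i + y i * m ≤ᵇ g} holds

    low : ∀ i a → i < m → i + a * m ≤ g → χ Λ (i + a * m) ≡ (at 0 (applyUpTo y m) i ≤ᵇ a)
    low i a i<m n≤g rewrite at-applyUpTo 0 y i<m with χ Λ (i + a * m) in eq
    ... | true  = sym (≤⇒≤ᵇ≡true (first-least (present i) N a (cong₂ _∧_ (≤⇒≤ᵇ≡true n≤g) eq)))
    ... | false with first-holds (present i) N
    -- If the class has no element up to `g`, then `y i` is the default `N`, which exceeds every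
    -- quotient `a` that can occur.
    ...   | inj₁ none = sym (>⇒≤ᵇ≡false (≤-trans a<N (≤-reflexive (sym none))))
      where
      a<N : a < N
      a<N = ≤-<-trans (≤-trans (m≤m*n a m) (≤-trans (m≤n+m (a * m) i) n≤g)) g<N
    ...   | inj₂ (_ , holds) = sym (>⇒≤ᵇ≡false (≰⇒> λ y≤a → contradiction (trans (sym (χ-true Λ (later y≤a))) eq) λ ()))
      where
      later : y i ≤ a → elements Λ (i + a * m)
      later y≤a = subst (elements Λ) (trans (regroup i (y i) (a ∸ y i) m) (cong (λ x → i + x * m) (m+[n∸m]≡n y≤a)))
        (+-closed Λ (χ-element Λ (proj₂ (∧≡true {i + y i * m ≤ᵇ g} holds))) (multiple∈Λ (a ∸ y i)))
        where
        regroup : ∀ i y z m → i + y * m + z * m ≡ i + (y + z) * m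
        regroup = solve-∀

  -- With `τ = ν` and `d = ν * ν` there are at most `N / τ` chosen elements and, for a suitable `g`,
  -- at most `N * τ / d` exceptions; both bounds are `N / ν`. As `d ≤ s` too, `D`, `X` and `E` all
  -- range over the same `smallSets N s`.
  module Encode (Λ : NumericalSemigroup) (N m ν : ℕ) {{m≢0 : NonZero m}} .{{_ : NonZero ν}} (m≤N : m ≤ N)
                (multiple∈Λ : ∀ k → elements Λ (k * m)) (minimal-m : ∀ {n} → elements Λ n → n ≢ 0 → m ≤ n)
                (beyond-N : ∀ {n} → N ≤ n → elements Λ n)
                (νν≤s : ν * ν ≤ N / ν) (νν<m : ν * ν < m) where

    private
      s = N / ν
      d = ν * ν
      Λᵇ = χ Λ

      d>0 : 0 < d
      d>0 = *-mono-< (>-nonZero⁻¹ ν) (>-nonZero⁻¹ ν)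

      -- The numbers from 1 to `m - 1` are gaps, and `νν<m` makes them numerous enough.
      many-gaps : d ≤ Σ< N (𝟙 ∘ not ∘ Λᵇ)
      many-gaps = begin
        d                                                             ≤⟨ s≤s⁻¹ (≤-trans νν<m (≤-reflexive (sym (suc-pred m)))) ⟩
        pred m                                                        ≡⟨ trans (Σ<-const (pred m) 1) (*-identityʳ (pred m)) ⟨
        Σ< (pred m) (λ _ → 1)                                         ≡⟨ Σ<-cong (pred m) (λ i i<m → cong (𝟙 ∘ not) (sym (gap i i<m))) ⟩
        Σ< (pred m) (λ i → 𝟙 (not (Λᵇ (suc i))))                      ≤⟨ m≤n+m _ _ ⟩
        Σ< (suc (pred m)) (𝟙 ∘ not ∘ Λᵇ)                              ≡⟨ cong (λ x → Σ< x (𝟙 ∘ not ∘ Λᵇ)) (suc-pred m) ⟩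
        Σ< m (𝟙 ∘ not ∘ Λᵇ)                                           ≤⟨ m≤m+n _ _ ⟩
        Σ< m (𝟙 ∘ not ∘ Λᵇ) + Σ< (N ∸ m) (λ i → 𝟙 (not (Λᵇ (m + i)))) ≡⟨ Σ<-split m (N ∸ m) (𝟙 ∘ not ∘ Λᵇ) ⟨
        Σ< (m + (N ∸ m)) (𝟙 ∘ not ∘ Λᵇ)                               ≡⟨ cong (λ x → Σ< x (𝟙 ∘ not ∘ Λᵇ)) (m+[n∸m]≡n m≤N) ⟩
        Σ< N (𝟙 ∘ not ∘ Λᵇ)                                           ∎
        where
        open ≤-Reasoning
        gap : ∀ i → i < pred m → Λᵇ (suc i) ≡ false
        gap i i<m = dec-false (elements? Λ (suc i)) λ ∈Λ →
          <⇒≱ (≤-trans (s≤s i<m) (≤-reflexive (suc-pred m))) (minimal-m ∈Λ λ ())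

      h = proj₁ (top-elements N (not ∘ Λᵇ) d many-gaps)

      D₀ : ℕ → Bool
      D₀ n = (h ≤ᵇ n) ∧ not (Λᵇ n)

      Dₗ = applyUpTo D₀ N

      -- The fingerprint is run on the decoded list instead of `D₀`, so that `W` is literally the
      -- set that `optionsFor` computes.
      D : ℕ → Bool
      D = at false Dₗ

      D≡D₀ : ∀ n → D n ≡ D₀ n
      D≡D₀ n with n <? N
      ... | yes n<N = at-applyUpTo false D₀ n<N
      ... | no  n≮N = trans (at-applyUpTo-≥ false D₀ (≮⇒≥ n≮N)) (sym (trans (cong (λ b → (h ≤ᵇ n) ∧ not b) (χ-true Λ (beyond-N (≮⇒≥ n≮N)))) (∧-zeroʳ (h ≤ᵇ n))))

      D-size : Σ< N (𝟙 ∘ D) ≡ d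
      D-size = trans (Σ<-cong N (λ n _ → cong 𝟙 (D≡D₀ n))) (proj₂ (proj₂ (top-elements N (not ∘ Λᵇ) d many-gaps)))

      D-gap : ∀ {n} → D n ≡ true → Λᵇ n ≡ false
      D-gap {n} n∈D with Λᵇ n | proj₂ (∧≡true {h ≤ᵇ n} (trans (sym (D≡D₀ n)) n∈D))
      ... | false | _ = refl

      D-above : ∀ {n} → D n ≡ true → h ≤ n
      D-above {n} n∈D = ≤ᵇ≡true⇒≤ h n (proj₁ (∧≡true {h ≤ᵇ n} (trans (sym (D≡D₀ n)) n∈D)))

      open Fingerprint N ν D Λᵇ

      Xₗ = applyUpTo chosen N

      W : ℕ → Bool
      W = shadow D (at false Xₗ) N

      W≡covered : ∀ w → W w ≡ covered N w
      W≡covered w = trans (shadow-cong D N w (λ n n<N → at-applyUpTo false chosen n<N)) (sym (covered≡shadow N w))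

      X-small : Σ< N (𝟙 ∘ chosen) ≤ s
      X-small = m*n≤o⇒n≤o/m ν _ N (≤-trans (chosen-few N) (≤-trans (Σ<-mono N (λ w _ → 𝟙≤1 (covered N w))) (≤-reflexive (trans (Σ<-const N 1) (*-identityʳ N)))))

      E-small : ∀ g → Σ< N (𝟙 ∘ D) * Σ< N (𝟙 ∘ exceptional g) ≤ N * ν → Σ< N (𝟙 ∘ exceptional g) ≤ s
      E-small g dE≤Nν = m*n≤o⇒n≤o/m ν e N (*-cancelʳ-≤ (ν * e) N ν (begin
        ν * e * ν                  ≡⟨ regroup ν e ⟩
        d * e                      ≡⟨ cong (_* e) D-size ⟨
        Σ< N (𝟙 ∘ D) * e           ≤⟨ dE≤Nν ⟩
        N * ν                      ∎))
        where
        open ≤-Reasoning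
        e = Σ< N (𝟙 ∘ exceptional g)
        regroup : ∀ x y → x * y * x ≡ x * x * y
        regroup = solve-∀

      W-gap : ∀ n → W n ≡ true → Λᵇ n ≡ false
      W-gap n n∈W with covered-sound N n (trans (sym (W≡covered n)) n∈W)
      ... | x , x∈Λ , n+x∈D = dec-false (elements? Λ n) λ n∈Λ →
        contradiction (trans (sym (χ-true Λ (+-closed Λ n∈Λ (χ-element Λ x∈Λ)))) (D-gap n+x∈D)) λ ()

      E-exception : ∀ g → g < N → ∀ n → n ≤ g → Λᵇ n ≡ true → W (g ∸ n) ≡ false → at false (applyUpTo (exceptional g) N) n ≡ true
      E-exception g g<N n n≤g n∈Λ ∉W = trans (at-applyUpTo false (exceptional g) (≤-<-trans n≤g g<N))
        (cong₂ _∧_ n∈Λ (cong₂ (λ a b → a ∧ not b) (≤⇒≤ᵇ≡true n≤g) (trans (sym (W≡covered (g ∸ n))) ∉W)))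

      -- `D` contains every gap from `h` on, and `g`, being in `D`, is at least `h`.
      high : ∀ g → D g ≡ true → ∀ n → g < n → Λᵇ n ≡ not (D n)
      high g g∈D n g<n = trans (sym (not-involutive (Λᵇ n))) (cong not (sym (trans (D≡D₀ n)
        (cong (_∧ not (Λᵇ n)) (≤⇒≤ᵇ≡true (≤-trans (D-above g∈D) (<⇒≤ g<n)))))))

    code-exists : ∀ {ms} → m ∈ ms → ∃ λ c → c ∈ codes N s ms × HasCode Λ c
    code-exists m∈ms with below-average N D (λ g → Σ< N (𝟙 ∘ exceptional g)) (N * ν) (≤-trans d>0 (≤-reflexive (sym D-size))) exceptions-few
    ... | g , g<N , g∈D , dE≤Nν = (m , Dₗ , g , applyUpTo y m) ,
      ∈-codes {X = Xₗ} {E = applyUpTo (exceptional g) N} m∈ms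
        (∈-smallSets N s D₀ (≤-trans (≤-reflexive (trans (Σ<-cong N (λ n _ → cong 𝟙 (sym (D≡D₀ n)))) D-size)) νν≤s))
        (∈-smallSets N s chosen X-small) (∈-smallSets N s (exceptional g) (E-small g dE≤Nν)) g<N
        (∈-choices m _ y (λ i _ → y∈options i)) ,
      m≢0 , low , high g g∈D
      where open ClassCode Λ N m g g<N W (at false (applyUpTo (exceptional g) N)) multiple∈Λ W-gap (E-exception g g<N)

  module _ {a ℓ} (S : Setoid a ℓ) where
    open Setoid S using (Carrier; _≈_) renaming (sym to ≈-sym)

    lookup-unique : ∀ {xs : List Carrier} → SetoidUnique.Unique S xs → ∀ i j → lookup xs i ≈ lookup xs j → i ≡ j
    lookup-unique (x∉ ∷ u) zero    zero    _  = refl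
    lookup-unique (x∉ ∷ u) zero    (suc j) eq = contradiction eq (All.lookup x∉ (∈-lookup j))
    lookup-unique (x∉ ∷ u) (suc i) zero    eq = contradiction (≈-sym eq) (All.lookup x∉ (∈-lookup i))
    lookup-unique (x∉ ∷ u) (suc i) (suc j) eq = cong suc (lookup-unique u i j eq)

    -- Positions in `xs` are mapped to positions in `ys`. With a relation in place of a function, no
    -- encoding that respects `≈` is required.
    length-≤-codes : ∀ {b r} {B : Set b} (R : Carrier → B → Set r) → (∀ {x x′ y} → R x y → R x′ y → x ≈ x′) →
                     ∀ {xs ys} → SetoidUnique.Unique S xs → (∀ {x} → x ∈ xs → ∃ λ y → y ∈ ys × R x y) → length xs ≤ length ys
    length-≤-codes {B = B} R R-injective {xs} {ys} unique encode = injective⇒≤ {f = code} code-injective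
      where
      code : Fin (length xs) → Fin (length ys)
      code i = index (proj₁ (proj₂ (encode (∈-lookup {xs = xs} i))))
      code-injective : ∀ {i j} → code i ≡ code j → i ≡ j
      code-injective {i} {j} eq with encode (∈-lookup {xs = xs} i) | encode (∈-lookup {xs = xs} j)
      ... | y , y∈ , Ry | y′ , y′∈ , Ry′ with SetoidMembershipₚ.index-injective (setoid B) y∈ y′∈ eq
      ...   | refl = lookup-unique unique i j (R-injective Ry Ry′)

  length-codes : ∀ k c N s ms →
    (∀ {m} → m ∈ ms → ∀ {g} → g < N → ∀ W E → Σ< N (𝟙 ∘ E) ≤ s → k * Π< m (length ∘ Classes.options m g N W E) ≤ c) →
    let S = length (smallSets N s) in k * length (codes N s ms) ≤ length ms * (S * (S * (S * (N * c))))
  length-codes k c N s ms h =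
    length-concatMap-≤ k _ _ ms λ {m} m∈ →
    length-concatMap-≤ k _ _ (smallSets N s) λ {D} _ →
    length-concatMap-≤ k _ _ (smallSets N s) λ {X} _ →
    length-concatMap-≤ k _ _ (smallSets N s) λ {E} E∈ →
    ≤-trans (length-concatMap-≤ k c _ (upTo N) λ {g} g∈ → begin
      k * length (map (λ y → m , D , g , y) (choices (optionsFor N m D X E g) m))    ≡⟨ cong (k *_) (trans (length-map _ (choices (optionsFor N m D X E g) m)) (length-choices m (optionsFor N m D X E g))) ⟩
      k * Π< m (length ∘ optionsFor N m D X E g)                                     ≤⟨ h m∈ (∈-upTo⁻ g∈) (shadow (at false D) (at false X) N) (at false E) (smallSets-small N s E∈) ⟩
      c                                                                              ∎)
    (≤-reflexive (cong (_* c) (length-upTo N)))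
    where open ≤-Reasoning

  -- Many semigroups with the largest possible multiplicity

  open Setoid semigroupSetoid using () renaming (_≈_ to _≈ₛ_)

  [n+km]/m : ∀ n k m .{{_ : NonZero m}} → (n + k * m) / m ≡ n / m + k
  [n+km]/m n k m = trans (+-distrib-/-∣ʳ n (divides-refl k)) (cong (n / m +_) (m*n/n≡m k m))

  -- Closed under addition because two elements that are not multiples of m exceed f / 2.
  module Construction (m r p : ℕ) .{{_ : NonZero m}} (0<r : 0 < r) (r<m : r < m) (2≤p : 2 ≤ p) where

    f : ℕ
    f = r + p * m

    m≤f : m ≤ f
    m≤f = ≤-trans (m≤n*m m p {{>-nonZero (<⇒≤ 2≤p)}}) (m≤n+m (p * m) r)

    InClass : (ℕ → ℕ) → ℕ → Set
    InClass θ n = θ (n % m) ≤ n / m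

    Member : (ℕ → ℕ) → ℕ → Set
    Member θ n = f < n ⊎ n % m ≡ 0 ⊎ InClass θ n

    record Admissible (θ : ℕ → ℕ) : Set where
      field
        upper-half : ∀ {i} → i < m → i ≢ 0 → f < (i + θ i * m) + (i + θ i * m)
        avoids-f   : p < θ r

    module _ {θ : ℕ → ℕ} (adm : Admissible θ) where
      open Admissible adm

      Member-upper-half : ∀ {n} → n % m ≢ 0 → InClass θ n → f < n + n
      Member-upper-half {n} ≢0 θ≤ = <-≤-trans (upper-half (m%n<n n m) ≢0) (+-mono-≤ ≤n ≤n)
        where
        ≤n : n % m + θ (n % m) * m ≤ n
        ≤n = ≤-trans (+-monoʳ-≤ (n % m) (*-monoˡ-≤ m θ≤)) (≤-reflexive (sym (m≡m%n+[m/n]*n n m)))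

      Member-+-multiple : ∀ {x y} → y % m ≡ 0 → Member θ x → Member θ (x + y)
      Member-+-multiple {x} {y} y%m≡0 x∈ with y / m | trans (m≡m%n+[m/n]*n y m) (cong (_+ y / m * m) y%m≡0)
      ... | k | refl = go x∈
        where
        go : Member θ x → Member θ (x + k * m)
        go (inj₁ f<x)         = inj₁ (≤-trans f<x (m≤m+n x (k * m)))
        go (inj₂ (inj₁ ≡0))   = inj₂ (inj₁ (trans ([m+kn]%n≡m%n x k m) ≡0))
        go (inj₂ (inj₂ θ≤))   = inj₂ (inj₂ (≤-trans (≤-reflexive (cong θ ([m+kn]%n≡m%n x k m)))
                                  (≤-trans θ≤ (≤-trans (m≤m+n (x / m) k) (≤-reflexive (sym ([n+km]/m x k m)))))))

      Member-+ : ∀ {x y} → Member θ x → Member θ y → Member θ (x + y)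
      Member-+ {x} {y} (inj₁ f<x) _ = inj₁ (≤-trans f<x (m≤m+n x y))
      Member-+ {x} {y} _ (inj₁ f<y) = inj₁ (≤-trans f<y (m≤n+m y x))
      Member-+ {x} {y} x∈ (inj₂ (inj₁ y≡0)) = Member-+-multiple y≡0 x∈
      Member-+ {x} {y} (inj₂ (inj₁ x≡0)) y∈ = subst (Member θ) (+-comm y x) (Member-+-multiple x≡0 y∈)
      Member-+ {x} {y} x∈@(inj₂ (inj₂ θx)) y∈@(inj₂ (inj₂ θy)) with x % m ≟ 0 | y % m ≟ 0
      ... | _      | yes y≡0 = Member-+-multiple y≡0 x∈
      ... | yes x≡0 | _      = subst (Member θ) (+-comm y x) (Member-+-multiple x≡0 y∈)
      ... | no x≢0 | no y≢0  = inj₁ (half {x} {y} (Member-upper-half x≢0 θx) (Member-upper-half y≢0 θy))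
        where
        half : ∀ {x y} → f < x + x → f < y + y → f < x + y
        half {x} {y} fx fy with ≤-total x y
        ... | inj₁ x≤y = <-≤-trans fx (+-monoʳ-≤ x x≤y)
        ... | inj₂ y≤x = <-≤-trans fy (+-monoˡ-≤ y y≤x)

      construct : NumericalSemigroup
      construct = record
        { elements          = Member θ
        ; elements?         = λ n → (f <? n) ⊎-dec ((n % m ≟ 0) ⊎-dec (θ (n % m) ≤? n / m))
        ; 0∈elements        = inj₂ (inj₁ (m*n%n≡0 0 m))
        ; +-closed          = λ {x} {y} → Member-+ {x} {y}
        ; finite-complement = upTo (suc f) , λ {n} n∉ → ∈-upTo⁺ (s≤s (≮⇒≥ (n∉ ∘ inj₁)))
        }

      f%m≡r : f % m ≡ r
      f%m≡r = trans ([m+kn]%n≡m%n r p m) (m<n⇒m%n≡m r<m)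

      f/m≡p : f / m ≡ p
      f/m≡p = trans ([n+km]/m r p m) (cong (_+ p) (m<n⇒m/n≡0 r<m))

      f∉ : ¬ Member θ f
      f∉ (inj₁ f<f)       = <-irrefl refl f<f
      f∉ (inj₂ (inj₁ ≡0)) = <-irrefl (sym (trans (sym f%m≡r) ≡0)) 0<r
      f∉ (inj₂ (inj₂ θ≤)) = <⇒≱ avoids-f (≤-trans (≤-reflexive (cong θ (sym f%m≡r))) (≤-trans θ≤ (≤-reflexive f/m≡p)))

      conductor-construct : conductor construct ≡ suc f
      conductor-construct = IsLeast-unique ((λ x → x) , (λ x → x)) (conductor-isLeast construct)
        ((λ k → inj₁ (m≤m+n (suc f) k)) , minimal)
        where
        minimal : ∀ k → ContainsFrom construct k → suc f ≤ k
        minimal k contains with k ≤? f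
        ... | yes k≤f = contradiction (subst (Member θ) (m+[n∸m]≡n k≤f) (contains (f ∸ k))) f∉
        ... | no  k≰f = ≰⇒> k≰f

      multiplicity-construct : multiplicity construct ≡ m
      multiplicity-construct = IsLeast-unique ((λ x → x) , (λ x → x)) (multiplicity-isLeast construct)
        ((inj₂ (inj₁ (n%n≡0 m)) , ≢-nonZero⁻¹ m) , minimal)
        where
        minimal : ∀ k → NonZeroElement construct k → m ≤ k
        minimal k (k∈ , k≢0) with m ≤? k
        ... | yes m≤k = m≤k
        ... | no  m≰k = contradiction k∈ k∉
          where
          k<m = ≰⇒> m≰k
          k∉ : ¬ Member θ k
          k∉ (inj₁ f<k)       = <⇒≱ (<-trans f<k k<m) m≤f
          k∉ (inj₂ (inj₁ ≡0)) = k≢0 (trans (sym (m<n⇒m%n≡m k<m)) ≡0)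
          -- Such a `k` would exceed `f / 2`, but `p ≥ 2` gives `2 k ≤ 2 m ≤ f`.
          k∉ (inj₂ (inj₂ θ≤)) = <⇒≱ f<2k (begin
              k + k            ≤⟨ +-mono-≤ (<⇒≤ k<m) (<⇒≤ k<m) ⟩
              m + m            ≡⟨ cong (m +_) (+-identityʳ m) ⟨
              2 * m            ≤⟨ *-monoˡ-≤ m 2≤p ⟩
              p * m            ≤⟨ m≤n+m (p * m) r ⟩
              f                ∎)
            where
            open ≤-Reasoning
            f<2k : f < k + k
            f<2k = Member-upper-half (λ ≡0 → k≢0 (trans (sym (m<n⇒m%n≡m k<m)) ≡0)) θ≤

      construct-frobenius-depth : HasFrobeniusAndDepth f (suc p) construct
      construct-frobenius-depth = cong (λ c → ℤ.+ c ℤ.- ℤ.1ℤ) conductor-construct ,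
        ceiling {{multiplicity-nonZero construct}} conductor-construct multiplicity-construct
        where
        quotient≡ : (suc f + pred m) / m ≡ suc p
        quotient≡ = begin
          (suc f + pred m) / m      ≡⟨ cong (_/ m) (trans (sym (+-suc f (pred m))) (cong (f +_) (suc-pred m))) ⟩
          (f + m) / m               ≡⟨ cong (λ x → (f + x) / m) (+-identityʳ m) ⟨
          (f + 1 * m) / m           ≡⟨ [n+km]/m f 1 m ⟩
          f / m + 1                 ≡⟨ cong (_+ 1) f/m≡p ⟩
          p + 1                     ≡⟨ +-comm p 1 ⟩
          suc p                     ∎
          where open ≡-Reasoning
        ceiling : ∀ {c n} .{{_ : NonZero n}} → c ≡ suc f → n ≡ m → ⌈ c / n ⌉ ≡ suc p
        ceiling refl refl = quotient≡

    -- If `θ i < θ′ i`, the number `i + θ i * m` lies in the first semigroup only: `θ′ i ≤ p` keeps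
    -- it at most `f`, where membership still depends on the threshold.
    construct-injective : ∀ {θ θ′} (adm : Admissible θ) (adm′ : Admissible θ′) → construct adm ≈ₛ construct adm′ →
                          ∀ {i} → i < m → i ≢ 0 → θ i ≤ p → θ′ i ≤ p → θ i ≡ θ′ i
    construct-injective {θ} {θ′} adm adm′ (to , from) {i} i<m i≢0 θ≤p θ′≤p =
      ≤-antisym (dominates θ′ θ from θ≤p) (dominates θ θ′ to θ′≤p)
      where
      dominates : ∀ θ θ′ → (∀ {n} → Member θ n → Member θ′ n) → θ′ i ≤ p → θ′ i ≤ θ i
      dominates θ θ′ sub θ′≤p with θ′ i ≤? θ i
      ... | yes θ′≤θ = θ′≤θ
      ... | no  θ′≰θ = contradiction (sub x∈) x∉
        where
        x = i + θ i * m
        x%m : x % m ≡ i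
        x%m = trans ([m+kn]%n≡m%n i (θ i) m) (m<n⇒m%n≡m i<m)
        x/m : x / m ≡ θ i
        x/m = trans ([n+km]/m i (θ i) m) (cong (_+ θ i) (m<n⇒m/n≡0 i<m))
        x∈ : Member θ x
        x∈ = inj₂ (inj₂ (≤-reflexive (trans (cong θ x%m) (sym x/m))))
        x∉ : ¬ Member θ′ x
        x∉ (inj₁ f<x)       = <⇒≱ f<x (begin
          i + θ i * m      ≤⟨ +-monoˡ-≤ (θ i * m) (<⇒≤ i<m) ⟩
          suc (θ i) * m    ≤⟨ *-monoˡ-≤ m (≤-trans (≰⇒> θ′≰θ) θ′≤p) ⟩
          p * m            ≤⟨ m≤n+m (p * m) r ⟩
          f                ∎)
          where open ≤-Reasoning
        x∉ (inj₂ (inj₁ ≡0)) = i≢0 (trans (sym x%m) ≡0)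
        x∉ (inj₂ (inj₂ θ≤)) = θ′≰θ (≤-trans (≤-reflexive (cong θ′ (sym x%m))) (≤-trans θ≤ (≤-reflexive x/m)))

  module Family (m r p n : ℕ) .{{_ : NonZero m}} (0<r : 0 < r) (2≤p : 2 ≤ p) (room : suc r + (n + n) ≤ m) where

    private
      r<m : r < m
      r<m = ≤-trans (m≤m+n (suc r) (n + n)) room

    open Construction m r p 0<r r<m 2≤p

    a b : ℕ
    a = ⌊ p /2⌋
    b = ⌈ p /2⌉

    -- In the class of r + 1 + j the elements beyond f / 2 have quotient at least b, and in the opposite
    -- class, that of m - 1 - j, at least a.
    threshold : (lo hi : Fin n → ℕ) → ℕ → ℕ
    threshold lo hi i with i ≤? r | (i ∸ suc r) <? n | (m ∸ suc i) <? n
    -- Numbers with quotient `suc p` exceed `f`, so this threshold admits nothing up to `f`, as the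
    -- class `r` of `f` requires.
    ... | yes _ | _     | _     = suc p
    ... | no _  | yes j | _     = b + lo (fromℕ< j)
    ... | no _  | no _  | yes j = a + hi (fromℕ< j)
    ... | no _  | no _  | no _  = suc p

    low-index high-index : Fin n → ℕ
    low-index  j = suc r + toℕ j
    high-index j = m ∸ suc (toℕ j)

    private
      n≤m : suc r + n ≤ m
      n≤m = ≤-trans (+-monoʳ-≤ (suc r) (m≤m+n n n)) room

    threshold-low : ∀ lo hi j → threshold lo hi (low-index j) ≡ b + lo j
    threshold-low lo hi j with low-index j ≤? r | (low-index j ∸ suc r) <? n | (m ∸ suc (low-index j)) <? n
    ... | yes i≤r | _      | _ = contradiction i≤r (<⇒≱ (m≤m+n (suc r) (toℕ j)))
    ... | no _    | yes j′ | _ = cong (λ k → b + lo k) (toℕ-injective (trans (toℕ-fromℕ< j′) (m+n∸m≡n (suc r) (toℕ j))))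
    ... | no _    | no j≮n | _ = contradiction (≤-trans (s≤s (≤-reflexive (m+n∸m≡n (suc r) (toℕ j)))) (toℕ<n j)) j≮n

    suc-high-index : ∀ j → suc (high-index j) + toℕ j ≡ m
    suc-high-index j = trans (sym (+-suc (high-index j) (toℕ j))) (m∸n+n≡m (≤-trans (toℕ<n j) (≤-trans (m≤n+m n (suc r)) n≤m)))

    high-index≥ : ∀ j → suc r + n ≤ high-index j
    high-index≥ j = +-cancelʳ-≤ (suc (toℕ j)) _ _ (begin
      suc r + n + suc (toℕ j)        ≤⟨ +-monoʳ-≤ (suc r + n) (toℕ<n j) ⟩
      suc r + n + n                  ≡⟨ +-assoc (suc r) n n ⟩
      suc r + (n + n)                ≤⟨ room ⟩
      m                              ≡⟨ trans (+-suc (high-index j) (toℕ j)) (suc-high-index j) ⟨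
      high-index j + suc (toℕ j)     ∎)
      where open ≤-Reasoning

    m∸suc[high-index] : ∀ j → m ∸ suc (high-index j) ≡ toℕ j
    m∸suc[high-index] j = trans (cong (_∸ suc (high-index j)) (sym (suc-high-index j))) (m+n∸m≡n (suc (high-index j)) (toℕ j))

    threshold-high : ∀ lo hi j → threshold lo hi (high-index j) ≡ a + hi j
    threshold-high lo hi j with high-index j ≤? r | (high-index j ∸ suc r) <? n | (m ∸ suc (high-index j)) <? n
    ... | yes i≤r | _      | _      = contradiction i≤r (<⇒≱ (≤-trans (m≤m+n (suc r) n) (high-index≥ j)))
    ... | no _    | yes i< | _      = contradiction (m+n≤o⇒n≤o∸m (suc r) (high-index≥ j)) (<⇒≱ i<)
      where
      m+n≤o⇒n≤o∸m : ∀ x {y z} → x + y ≤ z → y ≤ z ∸ x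
      m+n≤o⇒n≤o∸m x {y} {z} x+y≤z = ≤-trans (≤-reflexive (sym (m+n∸m≡n x y))) (∸-monoˡ-≤ x x+y≤z)
    ... | no _    | no _   | yes j′ = cong (λ k → a + hi k) (toℕ-injective (trans (toℕ-fromℕ< j′) (m∸suc[high-index] j)))
    ... | no _    | no _   | no j≮n = contradiction (≤-trans (s≤s (≤-reflexive (m∸suc[high-index] j))) (toℕ<n j)) j≮n

    -- For a low class, `i > r` and `p ≤ 2 b` suffice. For a high class only `p ≤ 2 a + 1` is
    -- available; the missing `m` comes from `r + 1 + m ≤ 2 i`, which `room` guarantees for
    -- `i ≥ m - n`.
    threshold-admissible : ∀ lo hi → Admissible (threshold lo hi)
    threshold-admissible lo hi = record { upper-half = λ {i} → upper i ; avoids-f = avoids }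
      where
      open ≤-Reasoning
      p≤b+b : p ≤ b + b
      p≤b+b = ≤-trans (≤-reflexive (sym (⌊n/2⌋+⌈n/2⌉≡n p))) (+-monoˡ-≤ b (⌊n/2⌋≤⌈n/2⌉ p))
      p≤1+a+a : p ≤ suc (a + a)
      p≤1+a+a = ≤-trans (≤-reflexive (sym (⌊n/2⌋+⌈n/2⌉≡n p))) (≤-trans (+-monoʳ-≤ a (⌈n/2⌉≤1+⌊n/2⌋ p)) (≤-reflexive (+-suc a a)))
        where
        ⌈n/2⌉≤1+⌊n/2⌋ : ∀ n → ⌈ n /2⌉ ≤ suc ⌊ n /2⌋
        ⌈n/2⌉≤1+⌊n/2⌋ n = ⌊n/2⌋-mono (n≤1+n (suc n))
      beyond : ∀ i → f < (i + suc p * m) + (i + suc p * m)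
      beyond i = <-≤-trans (<-≤-trans (+-monoˡ-< (p * m) r<m) (m≤n+m (suc p * m) i)) (m≤m+n _ _)
      upper : ∀ i → i < m → i ≢ 0 → f < (i + threshold lo hi i * m) + (i + threshold lo hi i * m)
      upper i i<m _ with i ≤? r | (i ∸ suc r) <? n | (m ∸ suc i) <? n
      ... | yes _  | _     | _     = beyond i
      ... | no _   | no _  | no _  = beyond i
      ... | no i≰r | yes j | _     = begin-strict
        r + p * m                                                ≤⟨ +-mono-≤ (<⇒≤ (≰⇒> i≰r)) (*-monoˡ-≤ m p≤b+b) ⟩
        i + (b + b) * m                                          <⟨ m<n+m _ (≤-trans 0<r (<⇒≤ (≰⇒> i≰r))) ⟩
        i + (i + (b + b) * m)                                    ≡⟨ regroup i b m ⟩
        (i + b * m) + (i + b * m)                                ≤⟨ +-mono-≤ more more ⟩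
        (i + (b + lo (fromℕ< j)) * m) + (i + (b + lo (fromℕ< j)) * m)    ∎
        where
        more : i + b * m ≤ i + (b + lo (fromℕ< j)) * m
        more = +-monoʳ-≤ i (*-monoˡ-≤ m (m≤m+n b _))
        regroup : ∀ i b m → i + (i + (b + b) * m) ≡ (i + b * m) + (i + b * m)
        regroup = solve-∀
      ... | no i≰r | no _  | yes j = begin-strict
        r + p * m                                                <⟨ +-mono-≤ ≤-refl (*-monoˡ-≤ m p≤1+a+a) ⟩
        suc r + (m + (a + a) * m)                                ≡⟨ +-assoc (suc r) m _ ⟨
        suc r + m + (a + a) * m                                  ≤⟨ +-monoˡ-≤ ((a + a) * m) r+m≤i+i ⟩
        i + i + (a + a) * m                                      ≡⟨ regroup i a m ⟩
        (i + a * m) + (i + a * m)                                ≤⟨ +-mono-≤ more more ⟩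
        (i + (a + hi (fromℕ< j)) * m) + (i + (a + hi (fromℕ< j)) * m)    ∎
        where
        more : i + a * m ≤ i + (a + hi (fromℕ< j)) * m
        more = +-monoʳ-≤ i (*-monoˡ-≤ m (m≤m+n a _))
        regroup : ∀ i b m → i + i + (b + b) * m ≡ (i + b * m) + (i + b * m)
        regroup = solve-∀
        m≤i+n : m ≤ i + n
        m≤i+n = begin
          m                      ≡⟨ m+[n∸m]≡n i<m ⟨
          suc i + (m ∸ suc i)    ≡⟨ +-suc i (m ∸ suc i) ⟨
          i + suc (m ∸ suc i)    ≤⟨ +-monoʳ-≤ i j ⟩
          i + n                  ∎
        r+m≤i+i : suc r + m ≤ i + i
        r+m≤i+i = +-cancelʳ-≤ (n + n) (suc r + m) (i + i) (begin
          suc r + m + (n + n)    ≡⟨ swap (suc r) m (n + n) ⟩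
          suc r + (n + n) + m    ≤⟨ +-monoˡ-≤ m room ⟩
          m + m                  ≤⟨ +-mono-≤ m≤i+n m≤i+n ⟩
          i + n + (i + n)        ≡⟨ interchange i n ⟩
          i + i + (n + n)        ∎)
          where
          swap : ∀ x y z → x + y + z ≡ x + z + y
          swap = solve-∀
          interchange : ∀ x y → x + y + (x + y) ≡ x + x + (y + y)
          interchange = solve-∀
      avoids : p < threshold lo hi r
      avoids with r ≤? r | (r ∸ suc r) <? n | (m ∸ suc r) <? n
      ... | yes _  | _ | _ = ≤-refl
      ... | no r≰r | _ | _ = contradiction ≤-refl r≰r

    private
      -- A digit in base `T p` splits into one of the `a + 1` thresholds `b` to `p` for a low class
      -- and one of the `b + 1` thresholds `a` to `p` for a high one. As both classes lie above `r`,
      -- threshold `p` means no element up to `f`.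
      digits : Fin (T p ^ n) → Fin n → Fin (suc a) × Fin (suc b)
      digits k j = remQuot (suc b) (finToFun k j)

      lo hi : Fin (T p ^ n) → Fin n → ℕ
      lo k j = toℕ (proj₁ (digits k j))
      hi k j = toℕ (proj₂ (digits k j))

      funToFin-cong : ∀ {k l} {u v : Fin k → Fin l} → (∀ j → u j ≡ v j) → funToFin u ≡ funToFin v
      funToFin-cong {zero}  u≗v = refl
      funToFin-cong {suc k} u≗v = cong₂ combine (u≗v Fin.zero) (funToFin-cong (u≗v ∘ Fin.suc))

      digits-injective : ∀ k k′ → (∀ j → lo k j ≡ lo k′ j) → (∀ j → hi k j ≡ hi k′ j) → k ≡ k′
      digits-injective k k′ lo≡ hi≡ = trans (sym (funToFin-finToFin {n} {T p} k)) (trans (funToFin-cong same) (funToFin-finToFin {n} {T p} k′))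
        where
        same : ∀ j → finToFun k j ≡ finToFun k′ j
        same j = trans (sym (combine-remQuot {suc a} (suc b) (finToFun k j)))
          (trans (cong₂ combine (toℕ-injective (lo≡ j)) (toℕ-injective (hi≡ j))) (combine-remQuot {suc a} (suc b) (finToFun k′ j)))

    member : Fin (T p ^ n) → NumericalSemigroup
    member k = construct (threshold-admissible (lo k) (hi k))

    member-injective : ∀ k k′ → member k ≈ₛ member k′ → k ≡ k′
    member-injective k k′ eq = digits-injective k k′
      (λ j → +-cancelˡ-≡ b _ _ (trans (sym (threshold-low (lo k) (hi k) j)) (trans
        (recover (low-index j) (≤-trans (+-monoʳ-< (suc r) (toℕ<n j)) n≤m) (λ ()) (low≤p k j) (low≤p k′ j))
        (threshold-low (lo k′) (hi k′) j))))
      (λ j → +-cancelˡ-≡ a _ _ (trans (sym (threshold-high (lo k) (hi k) j)) (trans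
        (recover (high-index j) (≤-trans (m≤m+n _ (toℕ j)) (≤-reflexive (suc-high-index j))) (m<n⇒n≢0 (≤-trans (m≤m+n (suc r) n) (high-index≥ j))) (high≤p k j) (high≤p k′ j))
        (threshold-high (lo k′) (hi k′) j))))
      where
      recover : ∀ i → i < m → i ≢ 0 → threshold (lo k) (hi k) i ≤ p → threshold (lo k′) (hi k′) i ≤ p → threshold (lo k) (hi k) i ≡ threshold (lo k′) (hi k′) i
      recover i i<m i≢0 = construct-injective (threshold-admissible (lo k) (hi k)) (threshold-admissible (lo k′) (hi k′)) eq i<m i≢0
      low≤p : ∀ k j → threshold (lo k) (hi k) (low-index j) ≤ p
      low≤p k j = ≤-trans (≤-reflexive (threshold-low (lo k) (hi k) j))
        (≤-trans (+-monoʳ-≤ b (s≤s⁻¹ (toℕ<n (proj₁ (digits k j))))) (≤-reflexive (trans (+-comm b a) (⌊n/2⌋+⌈n/2⌉≡n p))))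
      high≤p : ∀ k j → threshold (lo k) (hi k) (high-index j) ≤ p
      high≤p k j = ≤-trans (≤-reflexive (threshold-high (lo k) (hi k) j))
        (≤-trans (+-monoʳ-≤ a (s≤s⁻¹ (toℕ<n (proj₂ (digits k j))))) (≤-reflexive (⌊n/2⌋+⌈n/2⌉≡n p)))

    many-semigroups : T p ^ n ≤ size (semigroups f (suc p))
    many-semigroups = injective⇒≤ {f = position} (λ {k} {k′} eq → member-injective k k′
      (SetoidMembershipₚ.index-injective semigroupSetoid {member k} {member k′} (listed k) (listed k′) eq))
      where
      listed : ∀ k → _
      listed k = complete (semigroups f (suc p)) {member k} (construct-frobenius-depth (threshold-admissible (lo k) (hi k)))
      position : Fin (T p ^ n) → Fin (size (semigroups f (suc p)))
      position k = index (listed k)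

  -- Few semigroups with a distant multiplicity

  ^-cancelˡ-≤ : ∀ e {x y} → x ^ suc e ≤ y ^ suc e → x ≤ y
  ^-cancelˡ-≤ e {x} {y} xᵉ≤yᵉ = ≮⇒≥ λ y<x → <⇒≱ (^-monoˡ-< (suc e) y<x) xᵉ≤yᵉ

  -- What the family loses: the remainder is at most `p`, and at most `p + 2` of the `m` classes
  -- stay outside the `n` pairs.
  semigroups-bound : ℕ → ℕ
  semigroups-bound p = suc (p + p * (p + 2))

  semigroups-size : ∀ p f → 2 ≤ p → p * suc p < f →
    ∃ λ n → T p ^ n ≤ size (semigroups f (suc p)) × suc f ≤ p * (n + n) + semigroups-bound p
  semigroups-size p (suc f) 2≤p (s≤s large) = n ,
    subst (λ x → T p ^ n ≤ size (semigroups x (suc p))) (sym f≡) many-semigroups , (begin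
      suc (suc f)                                   ≡⟨ cong suc f≡ ⟩
      suc (r + p * m)                               ≤⟨ s≤s (+-mono-≤ r≤p (*-monoʳ-≤ p m≤)) ⟩
      suc (p + p * (p + 2 + (n + n)))               ≡⟨ regroup p (n + n) ⟩
      p * (n + n) + semigroups-bound p              ∎)
    where
    open ≤-Reasoning
    instance
      p≢0 : NonZero p
      p≢0 = >-nonZero (<⇒≤ 2≤p)
    -- The Frobenius number is `suc f` here. Dividing its predecessor puts `r` between 1 and `p`,
    -- never at 0, where `m` would divide the Frobenius number.
    m = f / p
    r = suc (f % p)
    n = ⌊ m ∸ suc r /2⌋
    r≤p : r ≤ p
    r≤p = m%n<n f p
    f≡ : suc f ≡ r + p * m
    f≡ = cong suc (trans (m≡m%n+[m/n]*n f p) (cong (f % p +_) (*-comm m p)))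
    r<m : suc r ≤ m
    r<m = ≤-trans (s≤s r≤p) (m*n≤o⇒n≤o/m p (suc p) f large)
    instance
      m≢0 : NonZero m
      m≢0 = >-nonZero (≤-trans z<s r<m)
    halves : ∀ x → ⌊ x /2⌋ + ⌊ x /2⌋ ≤ x
    halves x = ≤-trans (+-monoʳ-≤ ⌊ x /2⌋ (⌊n/2⌋≤⌈n/2⌉ x)) (≤-reflexive (⌊n/2⌋+⌈n/2⌉≡n x))
    room : suc r + (n + n) ≤ m
    room = ≤-trans (+-monoʳ-≤ (suc r) (halves (m ∸ suc r))) (≤-reflexive (m+[n∸m]≡n r<m))
    open Family m r p n z<s 2≤p room using (many-semigroups)
    halves′ : ∀ x → x ≤ suc (⌊ x /2⌋ + ⌊ x /2⌋)
    halves′ x = ≤-trans (≤-reflexive (sym (⌊n/2⌋+⌈n/2⌉≡n x))) (≤-trans (+-monoʳ-≤ ⌊ x /2⌋ (⌊n/2⌋-mono (n≤1+n (suc x)))) (≤-reflexive (+-suc _ _)))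
    m≤ : m ≤ p + 2 + (n + n)
    m≤ = begin
      m                              ≡⟨ m+[n∸m]≡n r<m ⟨
      suc r + (m ∸ suc r)            ≤⟨ +-mono-≤ (s≤s r≤p) (halves′ (m ∸ suc r)) ⟩
      suc p + suc (n + n)            ≡⟨ shift p (n + n) ⟩
      p + 2 + (n + n)                ∎
      where
      shift : ∀ p x → suc p + suc x ≡ p + 2 + x
      shift = solve-∀
    regroup : ∀ p x → suc (p + p * (p + 2 + x)) ≡ p * x + suc (p + p * (p + 2))
    regroup = solve-∀

  -- Up to a constant, the bound for Z² exceeds (tⁿ)² at most by Y² times the (r + 1)/p-th power of uᵖ / tᵖ⁺¹ < 1,
  -- which outweighs the subexponential Y as soon as r is at least f / M.
  compare-bounds : ∀ t u p M r m n N C Y Z → .{{_ : NonZero t}} .{{_ : NonZero p}} .{{_ : NonZero M}} → r < m → N ≡ suc (r + p * m) → N ≤ M * suc r →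
    N ≤ p * (n + n) + C → u ^ p < t ^ suc p →
    Z * Z ≤ (Y * Y) * (u ^ suc r * t ^ (m ∸ suc r)) →
    Y ^ (2 * p * M) * t ^ (C * M) * (u ^ p) ^ N ≤ (t ^ suc p) ^ N →
    Z ≤ t ^ n
  compare-bounds t u p@(suc p-1) M@(suc M-1) r m n N C Y Z r<m N≡ N≤MR N≤ P<Q Z²≤ sub = ^-cancelˡ-≤ (p-1 + (p + 0)) (*-cancelʳ-≤ (Z ^ (2 * p)) (L ^ (2 * p)) (Q ^ R) {{m^n≢0 Q R {{m^n≢0 t (suc p)}}}} (begin
    Z ^ (2 * p) * Q ^ R                              ≡⟨ cong (_* Q ^ R) (^-*-assoc Z 2 p) ⟨
    (Z ^ 2) ^ p * Q ^ R                              ≤⟨ *-monoˡ-≤ (Q ^ R) (^-monoˡ-≤ p Z²≤′) ⟩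
    (Y ^ 2 * V) ^ p * Q ^ R                          ≡⟨ cong (_* Q ^ R) (trans (^-distribʳ-* p (Y ^ 2) V) (cong (_* V ^ p) (^-*-assoc Y 2 p))) ⟩
    Y ^ (2 * p) * V ^ p * Q ^ R                      ≡⟨ *-assoc (Y ^ (2 * p)) (V ^ p) (Q ^ R) ⟩
    Y ^ (2 * p) * (V ^ p * Q ^ R)                    ≡⟨ cong (Y ^ (2 * p) *_) VQ≡ ⟩
    Y ^ (2 * p) * (P ^ R * t ^ N)                    ≤⟨ *-monoʳ-≤ (Y ^ (2 * p)) (*-monoʳ-≤ (P ^ R) tᴺ≤) ⟩
    Y ^ (2 * p) * (P ^ R * (L ^ (2 * p) * t ^ C))    ≡⟨ regroup (Y ^ (2 * p)) (P ^ R) (L ^ (2 * p)) (t ^ C) ⟩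
    L ^ (2 * p) * (Y ^ (2 * p) * t ^ C * P ^ R)      ≤⟨ *-monoʳ-≤ (L ^ (2 * p)) (^-cancelˡ-≤ M-1 root) ⟩
    L ^ (2 * p) * Q ^ R                              ∎))
    where
    open ≤-Reasoning
    R = suc r
    P = u ^ p
    Q = t ^ suc p
    V = u ^ R * t ^ (m ∸ R)
    L = t ^ n
    regroup : ∀ a b c d → a * (b * (c * d)) ≡ c * (a * d * b)
    regroup = solve-∀
    Z²≤′ : Z ^ 2 ≤ Y ^ 2 * V
    Z²≤′ = ≤-trans (≤-reflexive (cong (Z *_) (*-identityʳ Z))) (≤-trans Z²≤ (≤-reflexive (cong (λ x → Y * x * V) (sym (*-identityʳ Y)))))
    -- Counts the `N` numbers up to the Frobenius number by classes modulo `m`: `R` classes with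
    -- `p + 1` of them, the others with `p`.
    exponent : (m ∸ R) * p + suc p * R ≡ N
    exponent = trans (collect (m ∸ R) p r) (trans (cong (λ x → suc (r + p * x)) (m+[n∸m]≡n r<m)) (sym N≡))
      where
      collect : ∀ x p r → x * p + suc p * suc r ≡ suc (r + p * (suc r + x))
      collect = solve-∀
    VQ≡ : V ^ p * Q ^ R ≡ P ^ R * t ^ N
    VQ≡ = begin-equality
      V ^ p * Q ^ R                                          ≡⟨ cong (_* Q ^ R) (^-distribʳ-* p (u ^ R) (t ^ (m ∸ R))) ⟩
      (u ^ R) ^ p * (t ^ (m ∸ R)) ^ p * Q ^ R                ≡⟨ *-assoc ((u ^ R) ^ p) _ _ ⟩
      (u ^ R) ^ p * ((t ^ (m ∸ R)) ^ p * Q ^ R)              ≡⟨ cong₂ (λ x y → x * (y * Q ^ R)) (^-swap u R p) (^-*-assoc t (m ∸ R) p) ⟩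
      P ^ R * (t ^ ((m ∸ R) * p) * Q ^ R)                    ≡⟨ cong (λ x → P ^ R * (t ^ ((m ∸ R) * p) * x)) (^-*-assoc t (suc p) R) ⟩
      P ^ R * (t ^ ((m ∸ R) * p) * t ^ (suc p * R))          ≡⟨ cong (P ^ R *_) (^-distribˡ-+-* t ((m ∸ R) * p) (suc p * R)) ⟨
      P ^ R * t ^ ((m ∸ R) * p + suc p * R)                  ≡⟨ cong (λ x → P ^ R * t ^ x) exponent ⟩
      P ^ R * t ^ N                                          ∎
    tᴺ≤ : t ^ N ≤ L ^ (2 * p) * t ^ C
    tᴺ≤ = begin
      t ^ N                              ≤⟨ ^-monoʳ-≤ t N≤ ⟩
      t ^ (p * (n + n) + C)              ≡⟨ ^-distribˡ-+-* t (p * (n + n)) C ⟩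
      t ^ (p * (n + n)) * t ^ C          ≡⟨ cong (λ x → t ^ x * t ^ C) (double p n) ⟩
      t ^ (n * (2 * p)) * t ^ C          ≡⟨ cong (_* t ^ C) (^-*-assoc t n (2 * p)) ⟨
      L ^ (2 * p) * t ^ C                ∎
      where
      double : ∀ p n → p * (n + n) ≡ n * (2 * p)
      double = solve-∀
    -- The power `M` replaces `R` by `M * R ≥ N`, so that `sub` applies; the surplus `D` does no
    -- harm since `P < Q`.
    root : (Y ^ (2 * p) * t ^ C * P ^ R) ^ M ≤ (Q ^ R) ^ M
    root = begin
      (Y ^ (2 * p) * t ^ C * P ^ R) ^ M                      ≡⟨ trans (^-distribʳ-* M (Y ^ (2 * p) * t ^ C) (P ^ R)) (cong (_* (P ^ R) ^ M) (^-distribʳ-* M (Y ^ (2 * p)) (t ^ C))) ⟩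
      (Y ^ (2 * p)) ^ M * (t ^ C) ^ M * (P ^ R) ^ M          ≡⟨ cong₂ (λ x y → x * y * (P ^ R) ^ M) (^-*-assoc Y (2 * p) M) (^-*-assoc t C M) ⟩
      X * (P ^ R) ^ M                                        ≡⟨ cong (X *_) (split P) ⟩
      X * (P ^ N * P ^ D)                                    ≡⟨ *-assoc X (P ^ N) (P ^ D) ⟨
      X * P ^ N * P ^ D                                      ≤⟨ *-mono-≤ sub (^-monoˡ-≤ D (<⇒≤ P<Q)) ⟩
      Q ^ N * Q ^ D                                          ≡⟨ split Q ⟨
      (Q ^ R) ^ M                                            ∎
      where
      X = Y ^ (2 * p * M) * t ^ (C * M)
      D = M * R ∸ N
      split : ∀ x → (x ^ R) ^ M ≡ x ^ N * x ^ D
      split x = trans (^-*-assoc x R M) (trans (cong (x ^_) (trans (*-comm R M) (sym (m+[n∸m]≡n N≤MR)))) (^-distribˡ-+-* x N D))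

  -- At depth `p + 1` the difference `f ∸ p * m` is the remainder of `f` modulo `m`, so the
  -- deviation in the theorem is never negative and being far means `r ≥ f / M`.
  Far : ℕ → ℕ → ℕ → NumericalSemigroup → Set
  Far p M f Λ = f ≤ M * (f ∸ p * multiplicity Λ)

  FarMultiplicity : ℕ → ℕ → ℕ → ℕ → Set
  FarMultiplicity p M f m = p * m ≤ f × f ∸ p * m < m × f ≤ M * (f ∸ p * m)

  farMultiplicity? : ∀ p M f → Decidable (FarMultiplicity p M f)
  farMultiplicity? p M f m = (p * m ≤? f) ×-dec ((f ∸ p * m <? m) ×-dec (f ≤? M * (f ∸ p * m)))

  farMultiplicities : ℕ → ℕ → ℕ → List ℕ
  farMultiplicities p M f = filter (farMultiplicity? p M f) (upTo (suc f))

  module _ (Λ : NumericalSemigroup) (f p : ℕ) (FD : HasFrobeniusAndDepth f (suc p) Λ) where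

    private
      m = multiplicity Λ
      instance _ = multiplicity-nonZero Λ
    open SemigroupFacts Λ f p FD

    remainder≡ : ∃ λ r → 0 < r × r < multiplicity Λ × f ≡ r + p * multiplicity Λ
    remainder≡ = f % m , remainder>0 , m%n<n f m , f≡

    private
      p*m≤f : p * m ≤ f
      p*m≤f = ≤-trans (m≤n+m (p * m) (f % m)) (≤-reflexive (sym f≡))

      remainder<m : f ∸ p * m < m
      remainder<m = ≤-trans (s≤s (≤-reflexive (trans (cong (_∸ p * m) f≡) (m+n∸n≡m (f % m) (p * m))))) (m%n<n f m)

      m≤f : .{{_ : NonZero p}} → m ≤ f
      m≤f = ≤-trans (m≤n*m m p) p*m≤f

      small<m : ∀ ν → suc p * (ν * ν) ≤ f → ν * ν < m
      small<m ν large = *-cancelˡ-< (suc p) (ν * ν) m (begin-strict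
        suc p * (ν * ν)    ≤⟨ large ⟩
        f                  ≡⟨ f≡ ⟩
        f % m + p * m      <⟨ +-monoˡ-< (p * m) (m%n<n f m) ⟩
        suc p * m          ∎)
        where open ≤-Reasoning

    multiplicity∈farMultiplicities : ∀ M → .{{_ : NonZero p}} → Far p M f Λ → m ∈ farMultiplicities p M f
    multiplicity∈farMultiplicities M far = ∈-filter⁺ (farMultiplicity? p M f)
      (∈-upTo⁺ (s≤s m≤f)) (p*m≤f , remainder<m , far)

    encode : ∀ ν ms → .{{_ : NonZero p}} .{{_ : NonZero ν}} → ν * ν * ν ≤ suc f → suc p * (ν * ν) ≤ f → m ∈ ms →
             ∃ λ c → c ∈ codes (suc f) (suc f / ν) ms × HasCode Λ c
    encode ν ms ν³≤N large = Encode.code-exists Λ (suc f) m ν (m≤n⇒m≤1+n m≤f) multiple∈Λ minimal-m beyond-f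
      (m*n≤o⇒n≤o/m ν (ν * ν) (suc f) (≤-trans (≤-reflexive (*-comm ν (ν * ν))) ν³≤N)) (small<m ν large)

  farMultiplicities-sound : ∀ p M f {m} → m ∈ farMultiplicities p M f → FarMultiplicity p M f m
  farMultiplicities-sound p M f m∈ =
    proj₂ (∈-filter⁻ (farMultiplicity? p M f) {xs = upTo (suc f)} m∈)

  length-farMultiplicities : ∀ p M f → length (farMultiplicities p M f) ≤ suc f
  length-farMultiplicities p M f = ≤-trans (length-filter (farMultiplicity? p M f) (upTo (suc f))) (≤-reflexive (length-upTo (suc f)))

  product-few : ∀ p M f n C s k {m g} W E → .{{_ : NonZero p}} .{{_ : NonZero M}} → m ∈ farMultiplicities p M f → g < suc f →
    Σ< (suc f) (𝟙 ∘ E) ≤ s → suc f ≤ p * (n + n) + C → T (suc p) ^ p < T p ^ suc p →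
    (k * 2 ^ s) ^ (2 * p * M) * T p ^ (C * M) * (T (suc p) ^ p) ^ suc f ≤ (T p ^ suc p) ^ suc f →
    k * Π< m (length ∘ Classes.options m g (suc f) W E) ≤ T p ^ n
  product-few p M f n C s k {m} {g} W E m∈ g<N E≤s N≤ growth sub =
    compare-bounds (T p) (T (suc p)) p M r m n (suc f) C (k * 2 ^ s) (k * Z) r<m (cong suc f≡)
      (begin
        suc f        ≤⟨ s≤s (proj₂ (proj₂ m-far)) ⟩
        suc (M * r)  ≤⟨ +-monoˡ-≤ (M * r) (>-nonZero⁻¹ M) ⟩
        M + M * r    ≡⟨ *-suc M r ⟨
        M * suc r    ∎)
      N≤ growth
      (begin
        (k * Z) * (k * Z)                    ≡⟨ [m*n]*[o*p]≡[m*o]*[n*p] k Z k Z ⟩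
        (k * k) * (Z * Z)                    ≤⟨ *-monoʳ-≤ (k * k) (Π-options m g (suc f) W E {{>-nonZero (≤-trans z<s r<m)}} {p = p} g<N E≤s r<m (≤-trans (s≤s⁻¹ g<N) (≤-reflexive f≡))) ⟩
        (k * k) * ((2 ^ s * 2 ^ s) * V)      ≡⟨ regroup k (2 ^ s) V ⟩
        (k * 2 ^ s) * (k * 2 ^ s) * V        ∎)
      sub
    where
    open ≤-Reasoning
    m-far = farMultiplicities-sound p M f m∈
    r = f ∸ p * m
    r<m = proj₁ (proj₂ m-far)
    Z = Π< m (length ∘ Classes.options m g (suc f) W E)
    V = T (suc p) ^ suc r * T p ^ (m ∸ suc r)
    f≡ : f ≡ r + p * m
    f≡ = sym (m∸n+n≡m (proj₁ m-far))
    regroup : ∀ k x v → (k * k) * ((x * x) * v) ≡ (k * x) * (k * x) * v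
    regroup = solve-∀

  -- The weight `k` pays for all of a code except `y`: at most `N` values each of `m` and `g`, and
  -- `S` each of `D`, `X` and `E`. The factor `K` is left over.
  codes-few : ∀ K N s ms c → .{{_ : NonZero N}} → length ms ≤ N → let S = length (smallSets N s) ; k = K * (N * N) * (S * S * S) in
    (∀ {m} → m ∈ ms → ∀ {g} → g < N → ∀ W E → Σ< N (𝟙 ∘ E) ≤ s → k * Π< m (length ∘ Classes.options m g N W E) ≤ c) →
    K * length (codes N s ms) ≤ c
  codes-few K N s ms c ms≤N few = *-cancelˡ-≤ (N * N * (S * S * S)) {{NNSSS≢0}} (begin
    N * N * (S * S * S) * (K * l)            ≡⟨ regroup₁ N S K l ⟩
    k * l                                    ≤⟨ length-codes k c N s ms few ⟩
    length ms * (S * (S * (S * (N * c))))    ≤⟨ *-monoˡ-≤ (S * (S * (S * (N * c)))) ms≤N ⟩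
    N * (S * (S * (S * (N * c))))            ≡⟨ regroup₂ N S c ⟩
    N * N * (S * S * S) * c                  ∎)
    where
    open ≤-Reasoning
    S = length (smallSets N s)
    k = K * (N * N) * (S * S * S)
    l = length (codes N s ms)
    S≢0 : NonZero S
    S≢0 = >-nonZero (∈-length (∈-smallSets N s (λ _ → false) (≤-trans (≤-reflexive (trans (Σ<-const N 0) (*-zeroʳ N))) z≤n)))
    NNSSS≢0 : NonZero (N * N * (S * S * S))
    NNSSS≢0 = m*n≢0 (N * N) (S * S * S) {{m*n≢0 N N}} {{m*n≢0 (S * S) S {{m*n≢0 S S {{S≢0}} {{S≢0}}}} {{S≢0}}}}
    regroup₁ : ∀ N S K l → N * N * (S * S * S) * (K * l) ≡ K * (N * N) * (S * S * S) * l
    regroup₁ = solve-∀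
    regroup₂ : ∀ N S x → N * (S * (S * (S * (N * x)))) ≡ N * N * (S * S * S) * x
    regroup₂ = solve-∀

  -- With `c` the number of all semigroups considered, far ones make up at most the fraction
  -- `1 / K`. Any list without repetitions is allowed, so a filtered enumeration can be inserted.
  FarBound : ℕ → ℕ → ℕ → ℕ → ℕ → Set₁
  FarBound p M K f c = ∀ Λs → SetoidUnique.Unique semigroupSetoid Λs →
    (∀ {Λ} → Λ ∈ Λs → HasFrobeniusAndDepth f (suc p) Λ × Far p M f Λ) → K * length Λs ≤ c

  far-length : ∀ p M K → 2 ≤ p → .{{_ : NonZero M}} → ∃ λ f₀ → ∀ f → f₀ ≤ f → 0 < size (semigroups f (suc p)) × FarBound p M K f (size (semigroups f (suc p)))
  far-length p M K 2≤p = conclude (subexponential K (2 * p * M) (T p ^ (C * M)) (T (suc p) ^ p) (T p ^ suc p) {{m^n≢0 (T (suc p)) p}} growth)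
    where
    open ≤-Reasoning
    instance
      p≢0 : NonZero p
      p≢0 = >-nonZero (<⇒≤ 2≤p)
    C = semigroups-bound p
    growth = T-growth p 2≤p

    HasCode-≈ : ∀ {Λ Λ′ c} → HasCode Λ c → HasCode Λ′ c → Setoid._≈_ semigroupSetoid Λ Λ′
    HasCode-≈ {Λ} {Λ′} {c} h h′ = HasCode-injective Λ Λ′ {c} h h′ , HasCode-injective Λ′ Λ {c} h′ h

    conclude : (∃ λ ν → NonZero ν × ∃ λ n₀ → ∀ n → n₀ ≤ n → ∀ s S → s * ν ≤ n →
        (∀ b .{{_ : NonZero b}} → b ^ n * S ≤ b ^ s * suc b ^ n) →
        (K * (n * n) * (S * S * S) * 2 ^ s) ^ (2 * p * M) * T p ^ (C * M) * (T (suc p) ^ p) ^ n ≤ (T p ^ suc p) ^ n) →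
      ∃ λ f₀ → ∀ f → f₀ ≤ f → 0 < size (semigroups f (suc p)) × FarBound p M K f (size (semigroups f (suc p)))
    conclude (ν , ν≢0 , n₀ , sub) = f₀ , λ f f₀≤f → main f f₀≤f (semigroups-size p f 2≤p
        (m+n≤o⇒m≤o (suc (p * suc p)) f₀≤f))
      where
      instance _ = ν≢0
      -- The summands serve, in turn, the lower bound, the subexponential estimate, `ν * ν ≤ N / ν`,
      -- and `ν * ν < m`, the last because `f < (p + 1) m`.
      f₀ = suc (p * suc p) + (n₀ + (ν * ν * ν + suc p * (ν * ν)))
      main : ∀ f → f₀ ≤ f → (∃ λ n → T p ^ n ≤ size (semigroups f (suc p)) × suc f ≤ p * (n + n) + C) →
             0 < size (semigroups f (suc p)) × FarBound p M K f (size (semigroups f (suc p)))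
      main f f₀≤f (n , tⁿ≤size , N≤) = ≤-trans (m^n>0 (T p) n) tⁿ≤size , λ Λs unique far → begin
        K * length Λs                              ≤⟨ *-monoʳ-≤ K (length-≤-codes semigroupSetoid HasCode (λ {Λ} {Λ′} {c} → HasCode-≈ {Λ} {Λ′} {c}) unique (λ {Λ} Λ∈ → code Λ (far Λ∈))) ⟩
        K * length (codes (suc f) s ms)            ≤⟨ codes-few K (suc f) s ms (T p ^ n) (length-farMultiplicities p M f) (λ m∈ g<N W E E≤s →
                                                        product-few p M f n C s k W E m∈ g<N E≤s N≤ growth (sub (suc f) (m≤n⇒m≤1+n n₀≤f) s S (m/n*n≤m (suc f) ν) (λ b → length-smallSets (suc f) s b))) ⟩
        T p ^ n                                    ≤⟨ tⁿ≤size ⟩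
        size (semigroups f (suc p))                ∎
        where
        s = suc f / ν
        ms = farMultiplicities p M f
        S = length (smallSets (suc f) s)
        k = K * (suc f * suc f) * (S * S * S)
        rest : n₀ + (ν * ν * ν + suc p * (ν * ν)) ≤ f
        rest = m+n≤o⇒n≤o (suc (p * suc p)) f₀≤f
        n₀≤f : n₀ ≤ f
        n₀≤f = m+n≤o⇒m≤o n₀ rest
        rest′ : ν * ν * ν + suc p * (ν * ν) ≤ f
        rest′ = m+n≤o⇒n≤o n₀ rest
        code : ∀ Λ → HasFrobeniusAndDepth f (suc p) Λ × Far p M f Λ → ∃ λ c → c ∈ codes (suc f) s ms × HasCode Λ c
        code Λ (FD , far) = encode Λ f p FD ν ms (m≤n⇒m≤1+n (m+n≤o⇒m≤o (ν * ν * ν) rest′)) (m+n≤o⇒n≤o (ν * ν * ν) rest′)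
          (multiplicity∈farMultiplicities Λ f p FD M far)

open import Data.Rational.Base using (ℚ; 0ℚ; 1ℚ; _<_; _-_; ∣_∣)
import Data.Integer.Base as ℤ
import Data.Integer.Properties as ℤ
open import Data.Integer.Tactic.RingSolver using (solve-∀)
open import Data.List.Base using ([]; _∷_; filter; length)
open import Data.List.Membership.Propositional using (_∈_)
open import Data.List.Membership.Propositional.Properties using (∈-filter⁻)
import Data.List.Relation.Unary.All as All
import Data.List.Relation.Unary.Unique.Setoid.Properties as SetoidUniqueₚ
import Data.Nat.Base as ℕ
import Data.Nat.Properties as ℕ
open import Data.Product.Base using (_×_; _,_; proj₁; proj₂)
import Data.Rational.Base as ℚ
import Data.Rational.Properties as ℚ
open import Data.Rational.Unnormalised.Base as ℚᵘ using (mkℚᵘ; *≡*; *<*)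
import Data.Rational.Unnormalised.Properties as ℚᵘ
open import Function.Base using (_∘_)
open import Relation.Binary.PropositionalEquality using (_≡_; refl; sym; trans; cong; subst; subst₂)
open import Relation.Nullary using (¬_; yes; no)
open import Relation.Nullary.Decidable using (¬?)
open import Relation.Unary using (Pred; Decidable)

open Counting using (Far; FarBound; far-length; remainder≡)

-- The passage to probabilities

length-filter-¬ : ∀ {a p} {A : Set a} {P : Pred A p} (P? : Decidable P) xs →
                  length (filter P? xs) ℕ.+ length (filter (¬? ∘ P?) xs) ≡ length xs
length-filter-¬ P? []       = refl
length-filter-¬ P? (x ∷ xs) with P? x
... | yes _ = cong ℕ.suc (length-filter-¬ P? xs)
... | no  _ = trans (ℕ.+-suc _ _) (cong ℕ.suc (length-filter-¬ P? xs))

-- A positive rational has numerator at least 1 and so is at least the reciprocal of its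
-- denominator. This is how `ε` and `δ` become the natural numbers `M` and `K`.
a/b<ε : ∀ ε → 0ℚ < ε → ∀ a b .{{_ : NonZero b}} → ℚ.↧ₙ ε ℕ.* a ℕ.< b → ℤ.+ a ℚ./ b < ε
a/b<ε (ℚ.mkℚ (ℤ.+ ℕ.zero) d _) (ℚ.*<* (ℤ.+<+ ()))
a/b<ε (ℚ.mkℚ ℤ.-[1+ _ ] d _)   (ℚ.*<* ())
a/b<ε ε@(ℚ.mkℚ (ℤ.+ ℕ.suc n) d _) _ a (ℕ.suc b) da<b = ℚ.toℚᵘ-cancel-<
  (ℚᵘ.<-respˡ-≃ (ℚᵘ.≃-sym (ℚ.toℚᵘ-fromℚᵘ (mkℚᵘ (ℤ.+ a) b)))
    (*<* (subst₂ ℤ._<_ (ℤ.pos-* a (ℕ.suc d)) (ℤ.pos-* (ℕ.suc n) (ℕ.suc b))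
      (ℤ.+<+ (ℕ.<-≤-trans (ℕ.≤-<-trans (ℕ.≤-reflexive (ℕ.*-comm a (ℕ.suc d))) da<b) (ℕ.m≤m+n (ℕ.suc b) _))))))

a<ε*b : ∀ ε → 0ℚ < ε → ∀ a b → ℚ.↧ₙ ε ℕ.* a ℕ.< b → fromℤ (ℤ.+ a) < ε ℚ.* fromℤ (ℤ.+ b)
a<ε*b (ℚ.mkℚ (ℤ.+ ℕ.zero) d _) (ℚ.*<* (ℤ.+<+ ()))
a<ε*b (ℚ.mkℚ ℤ.-[1+ _ ] d _)   (ℚ.*<* ())
a<ε*b ε@(ℚ.mkℚ (ℤ.+ ℕ.suc n) d _) _ a b da<b = ℚ.toℚᵘ-cancel-<
  (ℚᵘ.<-respˡ-≃ (ℚᵘ.≃-sym (ℚ.toℚᵘ-fromℚᵘ (mkℚᵘ (ℤ.+ a) 0)))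
  (ℚᵘ.<-respʳ-≃ (ℚᵘ.≃-sym (ℚᵘ.≃-trans (ℚ.toℚᵘ-homo-* ε (fromℤ (ℤ.+ b))) (ℚᵘ.*-congˡ {mkℚᵘ (ℤ.+ ℕ.suc n) d} (ℚ.toℚᵘ-fromℚᵘ (mkℚᵘ (ℤ.+ b) 0)))))
    (*<* (subst₂ ℤ._<_ lhs rhs (ℤ.+<+ (ℕ.<-≤-trans da<b (ℕ.m≤m+n b (n ℕ.* b))))))))
  where
  lhs : ℤ.+ (ℕ.suc d ℕ.* a) ≡ ℤ.+ a ℤ.* ℤ.+ (ℕ.suc d ℕ.* 1)
  lhs = trans (cong ℤ.+_ (trans (ℕ.*-comm (ℕ.suc d) a) (cong (a ℕ.*_) (sym (ℕ.*-identityʳ (ℕ.suc d)))))) (ℤ.pos-* a (ℕ.suc d ℕ.* 1))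
  rhs : ℤ.+ (ℕ.suc n ℕ.* b) ≡ (ℤ.+ ℕ.suc n ℤ.* ℤ.+ b) ℤ.* ℤ.+ 1
  rhs = trans (ℤ.pos-* (ℕ.suc n) b) (sym (ℤ.*-identityʳ _))

∣a/b∣≡a/b : ∀ a b .{{_ : NonZero b}} → ∣ ℤ.+ a ℚ./ b ∣ ≡ ℤ.+ a ℚ./ b
∣a/b∣≡a/b a b = ℚ.0≤p⇒∣p∣≡p (ℚ.nonNegative⁻¹ _ {{ℚ.normalize-nonNeg a b}})

complementary : ∀ a b s .{{_ : NonZero s}} → a ℕ.+ b ≡ s → ℤ.+ a ℚ./ s - 1ℚ ≡ ℚ.- (ℤ.+ b ℚ./ s)
complementary a b s@(ℕ.suc s-1) a+b≡s = ℚ.toℚᵘ-injective (begin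
  ℚ.toℚᵘ (ℤ.+ a ℚ./ s - 1ℚ)                    ≈⟨ ℚ.toℚᵘ-homo-+ (ℤ.+ a ℚ./ s) (ℚ.- 1ℚ) ⟩
  ℚ.toℚᵘ (ℤ.+ a ℚ./ s) ℚᵘ.+ ℚ.toℚᵘ (ℚ.- 1ℚ)    ≈⟨ ℚᵘ.+-congˡ (ℚ.toℚᵘ (ℚ.- 1ℚ)) (ℚ.toℚᵘ-fromℚᵘ (mkℚᵘ (ℤ.+ a) s-1)) ⟩
  mkℚᵘ (ℤ.+ a) s-1 ℚᵘ.+ mkℚᵘ ℤ.-1ℤ 0           ≈⟨ *≡* identity ⟩
  ℚᵘ.- mkℚᵘ (ℤ.+ b) s-1                        ≈⟨ ℚᵘ.-‿cong (ℚ.toℚᵘ-fromℚᵘ (mkℚᵘ (ℤ.+ b) s-1)) ⟨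
  ℚᵘ.- ℚ.toℚᵘ (ℤ.+ b ℚ./ s)                    ≈⟨ ℚ.toℚᵘ-homo‿- (ℤ.+ b ℚ./ s) ⟨
  ℚ.toℚᵘ (ℚ.- (ℤ.+ b ℚ./ s))                   ∎)
  where
  open ℚᵘ.≃-Reasoning
  s≡ : ℤ.+ s ≡ ℤ.+ a ℤ.+ ℤ.+ b
  s≡ = trans (cong ℤ.+_ (sym a+b≡s)) (ℤ.pos-+ a b)
  ring : ∀ x y → (x ℤ.* ℤ.1ℤ ℤ.+ ℤ.-1ℤ ℤ.* (x ℤ.+ y)) ℤ.* (x ℤ.+ y) ≡ ℤ.- y ℤ.* ((x ℤ.+ y) ℤ.* ℤ.1ℤ)
  ring = solve-∀
  identity : (ℤ.+ a ℤ.* ℤ.1ℤ ℤ.+ ℤ.-1ℤ ℤ.* ℤ.+ s) ℤ.* ℤ.+ s ≡ ℤ.- (ℤ.+ b) ℤ.* ℤ.+ (s ℕ.* 1)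
  identity = trans (subst (λ z → (ℤ.+ a ℤ.* ℤ.1ℤ ℤ.+ ℤ.-1ℤ ℤ.* z) ℤ.* z ≡ ℤ.- (ℤ.+ b) ℤ.* (z ℤ.* ℤ.1ℤ)) (sym s≡) (ring (ℤ.+ a) (ℤ.+ b)))
    (cong (ℤ.- (ℤ.+ b) ℤ.*_) (sym (ℤ.pos-* s 1)))

¬near⇒far : ∀ p f ε m r → 0ℚ < ε → f ≡ r ℕ.+ p ℕ.* m →
  ¬ (∣ fromℤ (ℤ.+ f ℤ.- (ℤ.+ ℕ.suc p ℤ.- ℤ.1ℤ) ℤ.* ℤ.+ m) ∣ < ε ℚ.* fromℤ (ℤ.+ f)) → f ≤ ℚ.↧ₙ ε ℕ.* (f ℕ.∸ p ℕ.* m)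
¬near⇒far p f ε m r ε>0 f≡ ¬near = subst (λ x → f ≤ ℚ.↧ₙ ε ℕ.* x)
  (sym (trans (cong (ℕ._∸ p ℕ.* m) f≡) (ℕ.m+n∸n≡m r (p ℕ.* m))))
  (ℕ.≮⇒≥ λ <f → ¬near (subst (_< ε ℚ.* fromℤ (ℤ.+ f)) (sym (trans (cong (λ z → ∣ fromℤ z ∣) difference) (∣a/b∣≡a/b r 1))) (a<ε*b ε ε>0 r f <f)))
  where
  ring : ∀ r p m → r ℤ.+ p ℤ.* m ℤ.- (ℤ.1ℤ ℤ.+ p ℤ.- ℤ.1ℤ) ℤ.* m ≡ r
  ring = solve-∀
  difference : ℤ.+ f ℤ.- (ℤ.+ ℕ.suc p ℤ.- ℤ.1ℤ) ℤ.* ℤ.+ m ≡ ℤ.+ r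
  difference = trans
    (cong (λ z → z ℤ.- (ℤ.+ ℕ.suc p ℤ.- ℤ.1ℤ) ℤ.* ℤ.+ m) (trans (cong ℤ.+_ f≡) (trans (ℤ.pos-+ r (p ℕ.* m)) (cong (λ z → ℤ.+ r ℤ.+ z) (ℤ.pos-* p m)))))
    (ring (ℤ.+ r) (ℤ.+ p) (ℤ.+ m))

-- One more than the denominator of `δ` makes the inequality strict: the extra `b` is positive
-- unless `b = 0`, and then `s > 0` suffices.
fraction-near-1 : ∀ δ → 0ℚ < δ → ∀ a b s .{{_ : NonZero s}} → a ℕ.+ b ≡ s → ℕ.suc (ℚ.↧ₙ δ) ℕ.* b ≤ s → ∣ ℤ.+ a ℚ./ s - 1ℚ ∣ < δ
fraction-near-1 δ δ>0 a b s a+b≡s few = subst (_< δ)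
  (sym (trans (cong ∣_∣ (complementary a b s a+b≡s)) (trans (ℚ.∣-p∣≡∣p∣ (ℤ.+ b ℚ./ s)) (∣a/b∣≡a/b b s))))
  (a/b<ε δ δ>0 b s (strict b few))
  where
  strict : ∀ b → ℕ.suc (ℚ.↧ₙ δ) ℕ.* b ≤ s → ℚ.↧ₙ δ ℕ.* b ℕ.< s
  strict ℕ.zero    _  = ℕ.≤-<-trans (ℕ.≤-reflexive (ℕ.*-zeroʳ (ℚ.↧ₙ δ))) (ℕ.>-nonZero⁻¹ s)
  strict (ℕ.suc c) ≤s = ℕ.<-≤-trans (ℕ.m<n+m (ℚ.↧ₙ δ ℕ.* ℕ.suc c) ℕ.z<s) ≤s

module _ (p f : ℕ) (ε : ℚ) (ε>0 : 0ℚ < ε) (δ : ℚ) (δ>0 : 0ℚ < δ)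
         (En : Enumeration semigroupSetoid (HasFrobeniusAndDepth f (ℕ.suc p))) where

  private
    distant? : Decidable (λ Λ → ¬ Near f (ℕ.suc p) ε Λ)
    distant? Λ = ¬? (near? f (ℕ.suc p) ε Λ)

  distant⇒far : ∀ {Λ} → Λ ∈ filter distant? (list En) → HasFrobeniusAndDepth f (ℕ.suc p) Λ × Far p (ℚ.↧ₙ ε) f Λ
  distant⇒far {Λ} Λ∈ = FD , ¬near⇒far p f ε (multiplicity Λ) (proj₁ rem) ε>0 (proj₂ (proj₂ (proj₂ rem))) (proj₂ split)
    where
    split = ∈-filter⁻ distant? {xs = list En} Λ∈
    FD = All.lookup (sound En) (proj₁ split)
    rem = remainder≡ Λ f p FD

  concentration : 0 ℕ.< size En →
    FarBound p (ℚ.↧ₙ ε) (ℕ.suc (ℚ.↧ₙ δ)) f (size En) →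
    Σ (NonZero (size En)) λ nonempty → ∣ ℙ En (near? f (ℕ.suc p) ε) {{nonempty}} - 1ℚ ∣ < δ
  concentration size>0 few = nonempty , fraction-near-1 δ δ>0
    (length (filter (near? f (ℕ.suc p) ε) (list En))) (length (filter distant? (list En))) (size En) {{nonempty}}
    (length-filter-¬ (near? f (ℕ.suc p) ε) (list En))
    (few (filter distant? (list En)) (SetoidUniqueₚ.filter⁺ semigroupSetoid distant? (unique En)) distant⇒far)
    where nonempty = ℕ.>-nonZero size>0

theorem5p4 : (q : ℕ) → 3 ≤ q →
    (ε : ℚ) → 0ℚ < ε →
    (δ : ℚ) → 0ℚ < δ →
    ∃ λ (N : ℕ) → (f : ℕ) → N ≤ f →
    Σ (NonZero (size (semigroups f q))) λ nonempty →
    ∣ ℙ (semigroups f q) (near? f q ε) {{nonempty}} - 1ℚ ∣ < δ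
theorem5p4 (ℕ.suc p) (ℕ.s≤s 2≤p) ε ε>0 δ δ>0 = proj₁ bound , λ f f₀≤f →
  concentration p f ε ε>0 δ δ>0 (semigroups f (ℕ.suc p)) (proj₁ (proj₂ bound f f₀≤f)) (proj₂ (proj₂ bound f f₀≤f))
  where
  bound : ∃ λ f₀ → ∀ f → f₀ ≤ f → 0 ℕ.< size (semigroups f (ℕ.suc p)) ×
    FarBound p (ℚ.↧ₙ ε) (ℕ.suc (ℚ.↧ₙ δ)) f (size (semigroups f (ℕ.suc p)))
  bound = far-length p (ℚ.↧ₙ ε) (ℕ.suc (ℚ.↧ₙ δ)) 2≤p
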